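{- Let $m,n\ge 1$ and $b\in[-1,1]^m$. Let $q^*$ and $q_*$ be the supervertex and subvertex of $P(b)$ and set $\Gamma=\Gamma(\mathcal L^n,b)$. Let $F:\mathcal L^n\to\mathbb R$ be a truncated $\ell$-positive function. Then for any $P\in\Gamma$, any $0\le k\le n$ and any $\omega\in\mathcal L^{n-k}$ such that $P(A_\omega)>0$, $$E_P(F\mid A_\omega)\le E_{q^*}(F_{\omega- }).$$ In particular $F_{\max}(\Gamma)=E_{q^*}(F)$. The condition $q_*\in P(b)$ is equivalent to $\frac1m\sum_{i=1}^m b(i)\le \frac2m-1$. If $q_*\in P(b)$, then for any such $P$, $k$, $\omega$, $$E_P(F\mid A_\omega)\ge E_{q_*}(F_{\omega- }).$$ In particular, in this case, $F_{\min}(\Gamma)=E_{q_*}(F)$.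
   Context: Fix an integer $m\ge1$. $\mathcal L$ is the set of all functions $\lambda:\{1,\dots,m\}\to\{0,1\}$, with the convention $\lambda(0)=0$. $\mathbb R^{\mathcal L}$ is the space of functions $\mathcal L\to\mathbb R$ with standard basis $\{e_\lambda\}$ and standard inner product $\langle\ ,\ \rangle$. For $0\le i\le m$ let $\ell_i(\lambda)=(-1)^{\lambda(i)}$ (so $\ell_0$ is constant $1$). For $b\in\mathbb R^m$, $P(b)=\{x\in\mathbb R^{\mathcal L}: x(\lambda)\ge 0\ \forall\lambda,\ \langle \ell_0,x\rangle=1,\ \langle \ell_i,x\rangle=b(i)\text{ for }1\le i\le m\}$; its elements are probability density functions on $\mathcal L$. Truncation: $t^+=\max\{t,0\}$ for $t\in\mathbb R$, and $v^+(\lambda)=v(\lambda)^+$ for $v\in\mathbb R^{\mathcal L}$. $U_{\ell\text{ -pos}}$ is the set of vectors $\sum_{i=0}^m a_i\ell_i$ with $a_1,\dots,a_m>0$ ($a_0\in\mathbb R$ arbitrary), and $(U_{\ell\text{ -pos}})^+=\{\sum_{i=1}^k u_i^+ : u_i\in U_{\ell\text{ -pos}},\ k\ge0\}$. Elements of $\mathcal L^k$ are regarded as words of length $k$ in the alphabet $\mathcal L$; juxtaposition is concatenation. $F:\mathcal L^n\to\mathbb R$ is truncated $\ell$-positive if for all words $\omega,\tau$ of total length $n-1$ the function $\lambda\mapsto F(\omega\lambda\tau)$ belongs to $(U_{\ell\text{ -pos}})^+$. For $\omega\in\mathcal L^{n-k}$: $A_\omega=\{\omega\tau:\tau\in\mathcal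 L^k\}\subseteq\mathcal L^n$ and $F_{\omega- }:\mathcal L^k\to\mathbb R$, $F_{\omega- }(\tau)=F(\omega\tau)$. Let $\mathcal T^*$ be the set of words of length $<n$ in $\mathcal L$. For $\Phi:\mathcal T^*\to P(b)$ let $P(\Phi)$ be the probability density on $\mathcal L^n$ given by $P(\Phi)(\lambda_1\cdots\lambda_n)=\prod_{k=1}^n\Phi(\lambda_1\cdots\lambda_{k-1})(\lambda_k)$, and $\Gamma(\mathcal L^n,b)=\{P(\Phi):\Phi:\mathcal T^*\to P(b)\}$. $F_{\max}(\Gamma)$ and $F_{\min}(\Gamma)$ denote the maximum and minimum of $E_P(F)$ over $P\in\Gamma$. For a density $p$ on $\mathcal L$, $E_p$ of a function on $\mathcal L^k$ is the expectation with respect to the product measure $p^{\otimes k}$ on $\mathcal L^k$. Supervertex $q^*$ (for $b\in[-1,1]^m$): put $b(0)=1$, $b(m+1)=-1$. If $b(1)\ge\dots\ge b(m)$, set $b'(i)=\frac{b(i)-b(i+1)}2$ for $0\le i\le m$, let $\mu_i\in\mathcal L$ be $\mu_i(k)=0$ if $k\le i$ and $\mu_i(k)=1$ if $k\ge i+1$, and let $q^*=\sum_{i=0}^m b'(i)e_{\mu_i}$. For general $b$, choose a permutation $\sigma$ of $\{1,\dots,m\}$ with $b\circ\sigma^{ -1}$ decreasing; $q^*$ is the vector for which $\lambda\mapsto q^*(\lambda\circ\sigma)$ is the supervertex of $P(b\circ\sigma^{ -1})$ (independent of the choice of $\sigma$). The supervertex belongs to $P(b)$. Subvertex $q_*$ (for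 $b\in[-1,1]^m$): $\nu_i\in\mathcal L$, $0\le i\le m$, is $\nu_i(j)=1-\delta_{ij}$ for $1\le j\le m$; $b''(i)=\frac{b(i)+1}{2}$ for $1\le i\le m$, $b''(0)=1-\sum_{i=1}^m b''(i)$; and $q_*=\sum_{i=0}^m b''(i)e_{\nu_i}\in\mathbb R^{\mathcal L}$ (in general $q_*$ need not lie in $P(b)$). -}

module Defs where

open import Level using (Level; suc; _⊔_)
open import Algebra.Apartness.Bundles using (HeytingField)
open import Algebra.Bundles using (CommutativeRing; Semiring)
import Algebra.Definitions.RawSemiring as RawSemiringDefs
open import Data.Bool.Base using (if_then_else_)
open import Data.Fin.Base as Fin using (Fin; toℕ; inject₁)
  renaming (zero to fzero; suc to fsuc)
import Data.Fin.Properties as Finₚ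
open import Data.Fin.Permutation using (Permutation′; _⟨$⟩ʳ_; _⟨$⟩ˡ_)
open import Data.Nat.Base as ℕ using (ℕ; zero; NonZero; _≤ᵇ_)
open import Data.Product.Base using (∃; ∃-syntax; _×_; _,_; proj₁)
open import Data.Sum.Base using (_⊎_; inj₂)
open import Data.Vec.Base using (Vec; []; _∷_; _++_; cast; lookup; take; drop; tabulate)
open import Data.Vec.Functional as Vector using (Vector; insertAt)
open import Data.Vec.Properties using (≡-dec; take++drop≡id; cast-is-id; ++-injectiveˡ)
open import Function.Base using (_∘_)
open import Function.Bundles using (_⇔_; module Equivalence)
open Equivalence using (from)
open import Relation.Binary.Core using (Rel)
open import Relation.Binary.Definitions using (DecidableEquality)
open import Relation.Binary.Lattice.Definitions using (Supremum)
open import Relation.Binary.PropositionalEquality using (_≡_; refl; sym; trans)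
open import Relation.Binary.Structures using (IsStrictPartialOrder)
open import Relation.Nullary using (¬_; Dec; does; yes; no)
open import Relation.Unary using (Pred; Decidable; _∈_)

-- The real numbers, given axiomatically as an Archimedean, Cauchy
-- complete ordered field.  Classically ℝ is the only such field up to
-- isomorphism.  The axioms are the constructive ones (no decidability of
-- the order is assumed, and x ≤ y means ¬ y < x), so that they also hold
-- of the Cauchy reals with _≈_ as equality.

record RealNumbers (c ℓ₁ ℓ₂ ℓ₃ : Level) : Set (suc (c ⊔ ℓ₁ ⊔ ℓ₂ ⊔ ℓ₃)) where
  infix 4 _<_ _≤_
  field
    heytingField : HeytingField c ℓ₁ ℓ₂

  open HeytingField heytingField public
    renaming (Carrier to ℝ; refl to ≈-refl; sym to ≈-sym; trans to ≈-trans)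

  field
    _<_                  : Rel ℝ ℓ₃
    isStrictPartialOrder : IsStrictPartialOrder _≈_ _<_
    #⇔<                  : ∀ {x y} → (x # y) ⇔ (x < y ⊎ y < x)
    0<1                  : 0# < 1#
    +-monoˡ-<            : ∀ z {x y} → x < y → x + z < y + z
    *-pos                : ∀ {x y} → 0# < x → 0# < y → 0# < x * y

  _≤_ : Rel ℝ ℓ₃
  x ≤ y = ¬ (y < x)

  commutativeRing : CommutativeRing c ℓ₁
  commutativeRing = record { isCommutativeRing = isCommutativeRing }

  open RawSemiringDefs (Semiring.rawSemiring (CommutativeRing.semiring commutativeRing)) public
    using (sum; product; _^_) renaming (_×_ to _·_)

  fromℕ : ℕ → ℝ
  fromℕ n = n · 1#

  Cauchy : (ℕ → ℝ) → Set (c ⊔ ℓ₃)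
  Cauchy s = ∀ ε → 0# < ε →
    ∃[ N ] ∀ i j → N ℕ.≤ i → N ℕ.≤ j → s i < s j + ε

  _⟶_ : (ℕ → ℝ) → ℝ → Set (c ⊔ ℓ₃)
  s ⟶ x = ∀ ε → 0# < ε →
    ∃[ N ] ∀ i → N ℕ.≤ i → (s i < x + ε) × (x < s i + ε)

  field
    max          : ℝ → ℝ → ℝ
    max-supremum : Supremum _≤_ max
    archimedean  : ∀ x → ∃[ n ] x < fromℕ n
    complete     : ∀ s → Cauchy s → ∃[ x ] s ⟶ x

  open IsStrictPartialOrder isStrictPartialOrder public
    using (<-respʳ-≈; <-respˡ-≈) renaming (trans to <-trans; irrefl to <-irrefl)

  -- #⇒invertible inverts the difference y - 0#.
  infixl 7 _÷_[_]
  _÷_[_] : (x y : ℝ) → 0# < y → ℝ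
  x ÷ y [ 0<y ] = x * proj₁ (#⇒invertible (from #⇔< (inj₂ 0<y)))

  fromℕ-pos : ∀ n .{{_ : NonZero n}} → 0# < fromℕ n
  fromℕ-pos (ℕ.suc zero)      = <-respʳ-≈ (≈-sym (+-identityʳ 1#)) 0<1
  fromℕ-pos (ℕ.suc (ℕ.suc n)) =
    <-trans (fromℕ-pos (ℕ.suc n))
      (<-respˡ-≈ (+-identityˡ _) (+-monoˡ-< (fromℕ (ℕ.suc n)) 0<1))

module Theory {c ℓ₁ ℓ₂ ℓ₃} (ℛ : RealNumbers c ℓ₁ ℓ₂ ℓ₃) (m : ℕ) where

  open RealNumbers ℛ

  half : ℝ → ℝ
  half x = x ÷ fromℕ 2 [ fromℕ-pos 2 ]

  _⁺ : ℝ → ℝ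
  t ⁺ = max t 0#

  -- A function {1,…,m} → {0,1} is stored as its vector of values; the
  -- number j ∈ {1,…,m} is the element of Fin m with toℕ equal to j - 1.
  -- Families indexed by 0,…,m are indexed by Fin (suc m).
  𝓛 : Set
  𝓛 = Vec (Fin 2) m

  Word : ℕ → Set
  Word n = Vec 𝓛 n

  _≟𝓛_ : DecidableEquality 𝓛
  _≟𝓛_ = ≡-dec Finₚ._≟_

  ∑Vec : ∀ {a} {A : Set a} → ((A → ℝ) → ℝ) → ∀ n → (Vec A n → ℝ) → ℝ
  ∑Vec ∑A zero      f = f []
  ∑Vec ∑A (ℕ.suc n) f = ∑A λ x → ∑Vec ∑A n λ xs → f (x ∷ xs)

  ∑𝓛 : (𝓛 → ℝ) → ℝ
  ∑𝓛 = ∑Vec sum m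

  ∑Word : ∀ {n} → (Word n → ℝ) → ℝ
  ∑Word {n} = ∑Vec ∑𝓛 n

  ⟨_,_⟩ : (u v : 𝓛 → ℝ) → ℝ
  ⟨ u , v ⟩ = ∑𝓛 λ l → u l * v l

  e : 𝓛 → 𝓛 → ℝ
  e l l′ = if does (l ≟𝓛 l′) then 1# else 0#

  -- Prepending 0 implements the convention λ(0) = 0.
  ℓ : Fin (ℕ.suc m) → 𝓛 → ℝ
  ℓ i l = (- 1#) ^ toℕ (lookup (fzero ∷ l) i)

  Polytope : Vector ℝ m → Pred (𝓛 → ℝ) (ℓ₁ ⊔ ℓ₃)
  Polytope b x = (∀ l → 0# ≤ x l)
               × (⟨ ℓ fzero , x ⟩ ≈ 1#)
               × (∀ i → ⟨ ℓ (fsuc i) , x ⟩ ≈ b i)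

  Uℓ-pos : Pred (𝓛 → ℝ) (c ⊔ ℓ₁ ⊔ ℓ₃)
  Uℓ-pos u = ∃ λ (a : Vector ℝ (ℕ.suc m)) →
    (∀ i → 0# < a (fsuc i)) × (∀ l → u l ≈ sum λ i → a i * ℓ i l)

  Uℓ-pos⁺ : Pred (𝓛 → ℝ) (c ⊔ ℓ₁ ⊔ ℓ₃)
  Uℓ-pos⁺ v = ∃ λ (k : ℕ) → ∃ λ (u : Vector (𝓛 → ℝ) k) →
    (∀ i → u i ∈ Uℓ-pos) × (∀ l → v l ≈ sum λ i → u i l ⁺)

  -- Concatenation, with the total length named by an equation so that
  -- words of length n - k need no truncated subtraction.
  juxtapose : ∀ {a} {A : Set a} {j k n} → j ℕ.+ k ≡ n → Vec A j → Vec A k → Vec A n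
  juxtapose eq ω τ = cast eq (ω ++ τ)

  TruncatedPositive : ∀ {n} → Pred (Word n → ℝ) (c ⊔ ℓ₁ ⊔ ℓ₃)
  TruncatedPositive {n} F =
    ∀ {i j} (eq : i ℕ.+ ℕ.suc j ≡ n) (ω : Word i) (τ : Word j) →
    (λ l → F (juxtapose eq ω (l ∷ τ))) ∈ Uℓ-pos⁺

  restrict : ∀ {j k n} → j ℕ.+ k ≡ n → (Word n → ℝ) → Word j → Word k → ℝ
  restrict eq F ω τ = F (juxtapose eq ω τ)

  E : ∀ {n} → (Word n → ℝ) → (Word n → ℝ) → ℝ
  E P F = ∑Word λ x → P x * F x

  𝟙 : ∀ {a n} {A : Pred (Word n) a} → Decidable A → Word n → ℝ
  𝟙 A? x = if does (A? x) then 1# else 0#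

  prob : ∀ {a n} → (Word n → ℝ) → {A : Pred (Word n) a} → Decidable A → ℝ
  prob P A? = E P (𝟙 A?)

  condE : ∀ {a n} (P F : Word n → ℝ) {A : Pred (Word n) a} (A? : Decidable A) →
          0# < prob P A? → ℝ
  condE P F A? pos = E P (λ x → 𝟙 A? x * F x) ÷ prob P A? [ pos ]

  _⊗^_ : (𝓛 → ℝ) → ∀ k → Word k → ℝ
  (p ⊗^ k) τ = product λ i → p (lookup τ i)

  E⊗ : ∀ {k} → (𝓛 → ℝ) → (Word k → ℝ) → ℝ
  E⊗ {k} p G = E (p ⊗^ k) G

  Cylinder : ∀ {j k n} → j ℕ.+ k ≡ n → Word j → Pred (Word n) _
  Cylinder eq ω x = ∃[ τ ] x ≡ juxtapose eq ω τ

  Cylinder? : ∀ {j k n} (eq : j ℕ.+ k ≡ n) (ω : Word j) → Decidable (Cylinder eq ω)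
  Cylinder? {j} refl ω x with ≡-dec _≟𝓛_ (take j x) ω
  ... | yes refl = yes (drop j x , sym (trans (cast-is-id refl _) (take++drop≡id j x)))
  ... | no  ≢ω   = no λ where
    (τ , eq) → ≢ω (++-injectiveˡ (take j x) ω
      (trans (take++drop≡id j x) (trans eq (cast-is-id refl _))))

  prefix : ∀ {a} {A : Set a} {n} (k : Fin n) → Vec A n → Vec A (toℕ k)
  prefix fzero    _        = []
  prefix (fsuc k) (x ∷ xs) = x ∷ prefix k xs

  -- A function on words of length < n, split by that length.
  Strategy : ℕ → Set c
  Strategy n = (k : Fin n) → Word (toℕ k) → 𝓛 → ℝ

  density : ∀ {n} → Strategy n → Word n → ℝ
  density Φ x = product λ k → Φ k (prefix k x) (lookup x k)

  Γ : ∀ n → Vector ℝ m → Pred (Word n → ℝ) (c ⊔ ℓ₁ ⊔ ℓ₃)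
  Γ n b P = ∃ λ (Φ : Strategy n) →
    (∀ k ω → Φ k ω ∈ Polytope b) × (∀ x → P x ≈ density Φ x)

  IsMaximum IsMinimum : ∀ {a p} {X : Set a} → Pred X p → (X → ℝ) → ℝ → Set _
  IsMaximum S f M = (∃[ x ] x ∈ S × f x ≈ M) × (∀ x → x ∈ S → f x ≤ M)
  IsMinimum S f M = (∃[ x ] x ∈ S × f x ≈ M) × (∀ x → x ∈ S → M ≤ f x)

  Decreasing : Vector ℝ m → Set ℓ₃
  Decreasing b = ∀ {i j} → i Fin.≤ j → b j ≤ b i

  -- b(0), b(1), …, b(m), b(m+1) with b(0) = 1 and b(m+1) = -1.
  extend : Vector ℝ m → Vector ℝ (2 ℕ.+ m)
  extend b = 1# Vector.∷ insertAt b (Fin.fromℕ m) (- 1#)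

  b′ : Vector ℝ m → Vector ℝ (ℕ.suc m)
  b′ b i = half (extend b (inject₁ i) - extend b (fsuc i))

  μ : Fin (ℕ.suc m) → 𝓛
  μ i = tabulate λ k → if ℕ.suc (toℕ k) ≤ᵇ toℕ i then fzero else fsuc fzero

  sortedSupervertex : Vector ℝ m → 𝓛 → ℝ
  sortedSupervertex b l = sum λ i → b′ b i * e (μ i) l

  _∘𝓛_ : 𝓛 → Permutation′ m → 𝓛
  l ∘𝓛 σ = tabulate λ k → lookup l (σ ⟨$⟩ʳ k)

  -- Without a decision procedure for the order of ℝ a sorting permutation
  -- cannot be computed from b, so "choose σ" becomes an existential.
  IsSupervertex : Vector ℝ m → Pred (𝓛 → ℝ) (ℓ₁ ⊔ ℓ₃)
  IsSupervertex b q = ∃[ σ ] Decreasing (b ∘ (σ ⟨$⟩ˡ_))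
    × (∀ l → q (l ∘𝓛 σ) ≈ sortedSupervertex (b ∘ (σ ⟨$⟩ˡ_)) l)

  ν : Fin (ℕ.suc m) → 𝓛
  ν i = tabulate λ j → if does (i Finₚ.≟ fsuc j) then fzero else fsuc fzero

  b″ : Vector ℝ m → Vector ℝ (ℕ.suc m)
  b″ b fzero    = 1# - sum (λ i → half (b i + 1#))
  b″ b (fsuc i) = half (b i + 1#)

  subvertex : Vector ℝ m → 𝓛 → ℝ
  subvertex b l = sum λ i → b″ b i * e (ν i) l

{-# OPTIONS --safe #-}

-- A one-step density p ∈ P(b) only matters through its expectation of t⁺ for an
-- affine t that is increasing in every ℓᵢ.  As t ↦ t⁺ is convex, λ ↦ t(λ)⁺ is
-- supermodular on the cube.  Hence the affine function that agrees with it on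
-- the chain μ₀, …, μₘ (greedy increments) lies above it, and the affine function
-- that agrees with it on the star ν₀, …, νₘ lies below it.  Affine functions have
-- the same expectation under all elements of P(b), and q* and q_* live on the
-- chain and on the star, so q* maximises and q_* minimises the expectation of
-- truncated positive functions.  Replacing the steps of a strategy by q* (or q_*)
-- one at a time gives the bounds for words, and the constant strategy attains them.

module Submission where

open import Defs
open import Algebra.Bundles using (CommutativeRing)
open import Data.Bool.Base using (true; false; if_then_else_)
open import Data.Fin.Base as Fin using (Fin; inject₁) renaming (zero to fzero; suc to fsuc)
import Data.Fin.Permutation as Perm
open import Data.Fin.Permutation using (Permutation′; _⟨$⟩ʳ_; _⟨$⟩ˡ_; inverseʳ; inverseˡ)
import Data.Fin.Properties as Finₚ
open import Data.Integer.Base as ℤ using (ℤ; +_; -[1+_]; _⊖_)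
import Data.Integer.Properties as ℤ
open import Data.Maybe.Base using (just; nothing)
open import Data.Nat.Base as ℕ using (ℕ; zero; suc; NonZero; z≤n)
import Data.Nat.Properties as ℕₚ
open import Data.Product.Base using (_×_; _,_; proj₁; proj₂; ∃-syntax)
open import Data.Sum.Base using (_⊎_; inj₁; inj₂; [_,_])
open import Data.Vec.Base using (Vec; []; _∷_; lookup)
open import Data.Vec.Functional as Vector using (Vector; insertAt)
open import Data.Vec.Properties
  using (∷-injective; ∷-injectiveˡ; ∷-injectiveʳ; lookup∘tabulate; tabulate∘lookup; tabulate-cong; cast-is-id)
open import Function.Base using (_∘_; flip)
open import Function.Bundles using (_⇔_; mk⇔; module Equivalence)
import Function.Properties.Equivalence as ⇔
open import Level using (_⊔_; 0ℓ) renaming (suc to lsuc)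
open import Relation.Binary.Core using (Rel)
open import Relation.Binary.Definitions using (WeaklyDecidable)
open import Relation.Binary.PropositionalEquality as ≡ using (_≡_; _≢_)
open import Relation.Nullary using (¬_; yes; no; does; contradiction)
open import Relation.Nullary.Decidable using (does-⇔; dec-true; dec-false)
open import Relation.Unary using (_∈_)

-- Ring solving with integer coefficients.

-- With integer coefficients the ring solver recognises cancellations such as
-- x - x ≈ 0#, for which it would otherwise need a decision procedure on R.
module IntegerCoefficients {c ℓ} (R : CommutativeRing c ℓ) where

  open import Algebra.Solver.Ring.AlmostCommutativeRing
  open CommutativeRing R
  open import Algebra.Properties.Ring ring
  open import Algebra.Properties.AbelianGroup +-abelianGroup using (⁻¹-∙-comm)
  open import Algebra.Properties.Semiring.Mult semiring using (×1-homo-*)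
    renaming (_×_ to _×ᵤ_)
  open import Algebra.Properties.Monoid.Mult.TCOptimised +-monoid
    using (×ᵤ≈×; ×-homo-+)
    renaming (_×_ to _×′_)
  open import Relation.Binary.Reasoning.Setoid setoid

  -- The optimised multiple `×′` makes the images of 0 and 1 reduce to `0#` and `1#`, so solver
  -- constants match these terms by computation.
  ⟦_⟧ℤ : ℤ → Carrier
  ⟦ + n ⟧ℤ      = n ×′ 1#
  ⟦ -[1+ n ] ⟧ℤ = - (suc n ×′ 1#)

  ×′1-homo-* : ∀ m n → (m ℕ.* n) ×′ 1# ≈ (m ×′ 1#) * (n ×′ 1#)
  ×′1-homo-* m n = begin
    (m ℕ.* n) ×′ 1#           ≈⟨ ×ᵤ≈× (m ℕ.* n) 1# ⟨
    (m ℕ.* n) ×ᵤ 1#           ≈⟨ ×1-homo-* m n ⟩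
    (m ×ᵤ 1#) * (n ×ᵤ 1#)     ≈⟨ *-cong (×ᵤ≈× m 1#) (×ᵤ≈× n 1#) ⟩
    (m ×′ 1#) * (n ×′ 1#)     ∎

  -‿homoℤ : ∀ i → ⟦ ℤ.- i ⟧ℤ ≈ - ⟦ i ⟧ℤ
  -‿homoℤ (+ zero)    = sym -0#≈0#
  -‿homoℤ (+ (suc n)) = refl
  -‿homoℤ -[1+ n ]    = sym (-‿involutive _)

  ⊖-homo : ∀ m n → ⟦ m ⊖ n ⟧ℤ ≈ (m ×′ 1#) - (n ×′ 1#)
  ⊖-homo m       zero    = sym (trans (+-congˡ -0#≈0#) (+-identityʳ _))
  ⊖-homo zero    (suc n) = sym (+-identityˡ _)
  ⊖-homo (suc m) (suc n) = begin
    ⟦ suc m ⊖ suc n ⟧ℤ                      ≡⟨ ≡.cong ⟦_⟧ℤ (ℤ.[1+m]⊖[1+n]≡m⊖n m n) ⟩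
    ⟦ m ⊖ n ⟧ℤ                              ≈⟨ ⊖-homo m n ⟩
    (m ×′ 1#) - (n ×′ 1#)                   ≈⟨ +-congʳ (+-identityˡ _) ⟨
    (0# + m ×′ 1#) - (n ×′ 1#)              ≈⟨ +-congʳ (+-congʳ (-‿inverseʳ 1#)) ⟨
    ((1# - 1#) + m ×′ 1#) - (n ×′ 1#)       ≈⟨ +-congʳ (+-assoc _ _ _) ⟩
    (1# + (- 1# + m ×′ 1#)) - (n ×′ 1#)     ≈⟨ +-congʳ (+-congˡ (+-comm _ _)) ⟩
    (1# + (m ×′ 1# - 1#)) - (n ×′ 1#)       ≈⟨ +-congʳ (+-assoc _ _ _) ⟨
    ((1# + m ×′ 1#) - 1#) - (n ×′ 1#)       ≈⟨ +-assoc _ _ _ ⟩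
    (1# + m ×′ 1#) + (- 1# - (n ×′ 1#))     ≈⟨ +-congˡ (⁻¹-∙-comm _ _) ⟩
    (1# + m ×′ 1#) - (1# + n ×′ 1#)         ≈⟨ +-cong (×-homo-+ 1# 1 m) (-‿cong (×-homo-+ 1# 1 n)) ⟨
    (suc m ×′ 1#) - (suc n ×′ 1#)           ∎

  +-homoℤ : ∀ i j → ⟦ i ℤ.+ j ⟧ℤ ≈ ⟦ i ⟧ℤ + ⟦ j ⟧ℤ
  +-homoℤ (+ m)    (+ n)    = ×-homo-+ 1# m n
  +-homoℤ (+ m)    -[1+ n ] = ⊖-homo m (suc n)
  +-homoℤ -[1+ m ] (+ n)    = trans (⊖-homo n (suc m)) (+-comm _ _)
  +-homoℤ -[1+ m ] -[1+ n ] = begin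
    - (suc (suc (m ℕ.+ n)) ×′ 1#)           ≡⟨ ≡.cong (λ k → - (suc k ×′ 1#)) (ℕₚ.+-suc m n) ⟨
    - ((suc m ℕ.+ suc n) ×′ 1#)             ≈⟨ -‿cong (×-homo-+ 1# (suc m) (suc n)) ⟩
    - (suc m ×′ 1# + suc n ×′ 1#)           ≈⟨ ⁻¹-∙-comm _ _ ⟨
    - (suc m ×′ 1#) - (suc n ×′ 1#)         ∎

  +-*-homoℤ : ∀ m j → ⟦ (+ m) ℤ.* j ⟧ℤ ≈ ⟦ + m ⟧ℤ * ⟦ j ⟧ℤ
  +-*-homoℤ m (+ n) = begin
    ⟦ (+ m) ℤ.* (+ n) ⟧ℤ   ≡⟨ ≡.cong ⟦_⟧ℤ (ℤ.pos-* m n) ⟨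
    ⟦ + (m ℕ.* n) ⟧ℤ       ≈⟨ ×′1-homo-* m n ⟩
    ⟦ + m ⟧ℤ * ⟦ + n ⟧ℤ    ∎
  +-*-homoℤ m -[1+ n ] = begin
    ⟦ (+ m) ℤ.* -[1+ n ] ⟧ℤ          ≡⟨ ≡.cong ⟦_⟧ℤ (ℤ.neg-distribʳ-* (+ m) (+ suc n)) ⟨
    ⟦ ℤ.- ((+ m) ℤ.* (+ suc n)) ⟧ℤ   ≈⟨ -‿homoℤ ((+ m) ℤ.* (+ suc n)) ⟩
    - ⟦ (+ m) ℤ.* (+ suc n) ⟧ℤ       ≈⟨ -‿cong (+-*-homoℤ m (+ suc n)) ⟩
    - (⟦ + m ⟧ℤ * ⟦ + suc n ⟧ℤ)      ≈⟨ -‿distribʳ-* _ _ ⟩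
    ⟦ + m ⟧ℤ * ⟦ -[1+ n ] ⟧ℤ         ∎

  *-homoℤ : ∀ i j → ⟦ i ℤ.* j ⟧ℤ ≈ ⟦ i ⟧ℤ * ⟦ j ⟧ℤ
  *-homoℤ (+ m)    j = +-*-homoℤ m j
  *-homoℤ -[1+ m ] j = begin
    ⟦ -[1+ m ] ℤ.* j ⟧ℤ              ≡⟨ ≡.cong ⟦_⟧ℤ (ℤ.neg-distribˡ-* (+ suc m) j) ⟨
    ⟦ ℤ.- ((+ suc m) ℤ.* j) ⟧ℤ       ≈⟨ -‿homoℤ ((+ suc m) ℤ.* j) ⟩
    - ⟦ (+ suc m) ℤ.* j ⟧ℤ           ≈⟨ -‿cong (+-*-homoℤ (suc m) j) ⟩
    - (⟦ + suc m ⟧ℤ * ⟦ j ⟧ℤ)        ≈⟨ -‿distribˡ-* _ _ ⟩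
    ⟦ -[1+ m ] ⟧ℤ * ⟦ j ⟧ℤ           ∎

  morphism : ℤ.+-*-rawRing -Raw-AlmostCommutative⟶ fromCommutativeRing R
  morphism = record
    { ⟦_⟧    = ⟦_⟧ℤ
    ; +-homo = +-homoℤ
    ; *-homo = *-homoℤ
    ; -‿homo = -‿homoℤ
    ; 0-homo = refl
    ; 1-homo = refl
    }

  _≟ℤ_ : WeaklyDecidable (Induced-equivalence morphism)
  i ≟ℤ j with i ℤ.≟ j
  ... | yes ≡.refl = just refl
  ... | no  _      = nothing

  open import Algebra.Solver.Ring ℤ.+-*-rawRing (fromCommutativeRing R) morphism _≟ℤ_ public
    using (solve; con; _:+_; _:*_; _:-_; :-_; _:=_)

-- Order, reciprocals and truncation in the real numbers.

module OrderedField {c ℓ₁ ℓ₂ ℓ₃} (ℛ : RealNumbers c ℓ₁ ℓ₂ ℓ₃) where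

  open RealNumbers ℛ
  open CommutativeRing commutativeRing public using (semiring)
  open IntegerCoefficients commutativeRing public
  open import Algebra.Properties.Semiring.Sum semiring public
    using (sum-cong-≋; sum-replicate; sum-replicate-zero; sum-permute; ∑-distrib-+; *-distribˡ-sum; *-distribʳ-sum)

  ≤-reflexive : ∀ {x y} → x ≈ y → x ≤ y
  ≤-reflexive x≈y y<x = <-irrefl (≈-sym x≈y) y<x

  ≤-refl : ∀ {x} → x ≤ x
  ≤-refl = ≤-reflexive ≈-refl

  <⇒≤ : ∀ {x y} → x < y → x ≤ y
  <⇒≤ x<y y<x = <-irrefl ≈-refl (<-trans x<y y<x)

  ≮×≯⇒≈ : ∀ {x y} → ¬ x < y → ¬ y < x → x ≈ y
  ≮×≯⇒≈ {x} {y} x≮y y≮x = proj₁ (tight x y) λ x#y →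
    [ x≮y , y≮x ] (Equivalence.to #⇔< x#y)

  -- Without a decidable order, trichotomy holds only under a double negation. This still permits
  -- case analysis towards any goal `x ≤ y`, which is itself a negation.
  trichotomy : ∀ x y → ¬ ¬ (x < y ⊎ x ≈ y ⊎ y < x)
  trichotomy x y ¬tri =
    ¬tri (inj₂ (inj₁ (≮×≯⇒≈ (¬tri ∘ inj₁) (¬tri ∘ inj₂ ∘ inj₂))))

  ≤-trans : ∀ {x y z} → x ≤ y → y ≤ z → x ≤ z
  ≤-trans {x} {y} {z} x≤y y≤z z<x = trichotomy y z λ where
    (inj₁ y<z)        → x≤y (<-trans y<z z<x)
    (inj₂ (inj₁ y≈z)) → x≤y (<-respˡ-≈ (≈-sym y≈z) z<x)
    (inj₂ (inj₂ z<y)) → y≤z z<y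

  ≤-antisym : ∀ {x y} → x ≤ y → y ≤ x → x ≈ y
  ≤-antisym x≤y y≤x = ≮×≯⇒≈ y≤x x≤y

  ≤-resp-≈ : ∀ {x x′ y y′} → x ≈ x′ → y ≈ y′ → x ≤ y → x′ ≤ y′
  ≤-resp-≈ x≈x′ y≈y′ x≤y y′<x′ = x≤y (<-respˡ-≈ (≈-sym y≈y′) (<-respʳ-≈ (≈-sym x≈x′) y′<x′))

  +-cancelʳ-< : ∀ {x y} z → x + z < y + z → x < y
  +-cancelʳ-< {x} {y} z x+z<y+z =
    <-respˡ-≈ (cancel x) (<-respʳ-≈ (cancel y) (+-monoˡ-< (- z) x+z<y+z))
    where
    cancel : ∀ w → w + z + - z ≈ w
    cancel w = solve 2 (λ w z → w :+ z :+ :- z := w) ≈-refl w z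

  +-monoˡ-≤ : ∀ z {x y} → x ≤ y → x + z ≤ y + z
  +-monoˡ-≤ z x≤y = x≤y ∘ +-cancelʳ-< z

  +-mono-≤ : ∀ {x x′ y y′} → x ≤ x′ → y ≤ y′ → x + y ≤ x′ + y′
  +-mono-≤ {x} {x′} {y} {y′} x≤x′ y≤y′ = ≤-trans (+-monoˡ-≤ y x≤x′)
    (≤-resp-≈ (+-comm y x′) (+-comm y′ x′) (+-monoˡ-≤ x′ y≤y′))

  x≤y⇒0≤y-x : ∀ {x y} → x ≤ y → 0# ≤ y - x
  x≤y⇒0≤y-x {x} x≤y = ≤-resp-≈ (-‿inverseʳ x) ≈-refl (+-monoˡ-≤ (- x) x≤y)

  0≤y-x⇒x≤y : ∀ {x y} → 0# ≤ y - x → x ≤ y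
  0≤y-x⇒x≤y {x} {y} 0≤y-x = ≤-resp-≈ (+-identityˡ x)
    (solve 2 (λ x y → (y :- x) :+ x := y) ≈-refl x y) (+-monoˡ-≤ x 0≤y-x)

  *-nonneg : ∀ {x y} → 0# ≤ x → 0# ≤ y → 0# ≤ x * y
  *-nonneg {x} {y} 0≤x 0≤y xy<0 = trichotomy 0# x λ where
    (inj₂ (inj₁ 0≈x)) → <-irrefl (≈-trans (*-congʳ (≈-sym 0≈x)) (zeroˡ y)) xy<0
    (inj₂ (inj₂ x<0)) → 0≤x x<0
    (inj₁ 0<x) → trichotomy 0# y λ where
      (inj₂ (inj₁ 0≈y)) → <-irrefl (≈-trans (*-congˡ (≈-sym 0≈y)) (zeroʳ x)) xy<0
      (inj₂ (inj₂ y<0)) → 0≤y y<0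
      (inj₁ 0<y) → <⇒≤ (*-pos 0<x 0<y) xy<0

  *-monoˡ-≤ : ∀ {z x y} → 0# ≤ z → x ≤ y → z * x ≤ z * y
  *-monoˡ-≤ {z} {x} {y} 0≤z x≤y = 0≤y-x⇒x≤y (≤-resp-≈ ≈-refl
    (solve 3 (λ z x y → z :* (y :- x) := z :* y :- z :* x) ≈-refl z x y)
    (*-nonneg 0≤z (x≤y⇒0≤y-x x≤y)))

  -- The inverse hidden in `_÷_[_]`: the quotient `x ÷ y [ 0<y ]` unfolds to `x * recip 0<y`.
  recip : ∀ {y} → 0# < y → ℝ
  recip 0<y = proj₁ (#⇒invertible (Equivalence.from #⇔< (inj₂ 0<y)))

  recip-inverse : ∀ {y} (0<y : 0# < y) → recip 0<y * y ≈ 1#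
  recip-inverse {y} 0<y = ≈-trans
    (solve 2 (λ r y → r :* y := r :* (y :- con (+ 0))) ≈-refl (recip 0<y) y)
    (proj₁ (proj₂ (#⇒invertible (Equivalence.from #⇔< (inj₂ 0<y)))))

  -- A negative inverse `r` would make `- r * y`, that is `- 1#`, positive; adding `1#` would give
  -- `1# < 0#`.
  recip-nonneg : ∀ {y} (0<y : 0# < y) → 0# ≤ recip 0<y
  recip-nonneg {y} 0<y r<0 = <⇒≤ 0<1 (<-respˡ-≈ (+-identityˡ 1#)
    (<-respʳ-≈ (-‿inverseˡ 1#) (+-monoˡ-< 1# (<-respʳ-≈ -ry≈-1 (*-pos 0<-r 0<y)))))
    where
    r = recip 0<y
    0<-r : 0# < - r
    0<-r = <-respˡ-≈ (-‿inverseʳ r) (<-respʳ-≈ (+-identityˡ (- r)) (+-monoˡ-< (- r) r<0))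
    -ry≈-1 : - r * y ≈ - 1#
    -ry≈-1 = ≈-trans (solve 2 (λ r y → :- r :* y := :- (r :* y)) ≈-refl r y)
      (-‿cong (recip-inverse 0<y))

  ½ : ℝ
  ½ = recip (fromℕ-pos 2)

  -- Like `_⁺` below, this repeats an operation of `Theory` without the parameter `m`; each agrees
  -- with its namesake by unfolding.
  half : ℝ → ℝ
  half x = x * ½

  ½+½≈1 : ½ + ½ ≈ 1#
  ½+½≈1 = ≈-trans
    -- `fromℕ 2` unfolds to `1# + (1# + 0#)`, which is the factor on the right.
    (solve 1 (λ h → h :+ h := h :* (con (+ 1) :+ (con (+ 1) :+ con (+ 0)))) ≈-refl ½)
    (recip-inverse (fromℕ-pos 2))

  0≤½ : 0# ≤ ½
  0≤½ = recip-nonneg (fromℕ-pos 2)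

  0≤1 : 0# ≤ 1#
  0≤1 = <⇒≤ 0<1

  infix 9 _⁺
  _⁺ : ℝ → ℝ
  t ⁺ = max t 0#

  x≤x⁺ : ∀ x → x ≤ x ⁺
  x≤x⁺ x = proj₁ (max-supremum x 0#)

  0≤x⁺ : ∀ x → 0# ≤ x ⁺
  0≤x⁺ x = proj₁ (proj₂ (max-supremum x 0#))

  ⁺-least : ∀ {x z} → x ≤ z → 0# ≤ z → x ⁺ ≤ z
  ⁺-least {x} = proj₂ (proj₂ (max-supremum x 0#)) _

  ⁺-mono : ∀ {x y} → x ≤ y → x ⁺ ≤ y ⁺
  ⁺-mono {y = y} x≤y = ⁺-least (≤-trans x≤y (x≤x⁺ y)) (0≤x⁺ y)

  ⁺-cong : ∀ {x y} → x ≈ y → x ⁺ ≈ y ⁺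
  ⁺-cong x≈y = ≤-antisym (⁺-mono (≤-reflexive x≈y)) (⁺-mono (≤-reflexive (≈-sym x≈y)))

  x≤x+d : ∀ {x d} → 0# ≤ d → x ≤ x + d
  x≤x+d {x} 0≤d = ≤-resp-≈ (+-identityʳ x) ≈-refl (+-mono-≤ ≤-refl 0≤d)

  -- Convexity of `_⁺`. In the form `(x + d) ⁺ + y ⁺ ≤ x ⁺ + (y + d) ⁺`, the universal property of
  -- the maximum is applied to both truncations on the left, in place of a case distinction on
  -- signs.
  ⁺-increment : ∀ {x y d} → x ≤ y → 0# ≤ d → (x + d) ⁺ - x ⁺ ≤ (y + d) ⁺ - y ⁺
  ⁺-increment {x} {y} {d} x≤y 0≤d = ≤-resp-≈ ≈-refl
    (solve 3 (λ a b c → ((b :+ c) :- a) :+ (:- b) := c :- a) ≈-refl (y ⁺) (x ⁺) ((y + d) ⁺))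
    (+-monoˡ-≤ (- x ⁺) (⁺-least below (x≤y⇒0≤y-x nonneg)))
    where
    nonneg : y ⁺ ≤ x ⁺ + (y + d) ⁺
    nonneg = ≤-trans (⁺-mono (x≤x+d 0≤d))
      (≤-resp-≈ (+-identityˡ _) ≈-refl (+-monoˡ-≤ _ (0≤x⁺ x)))
    below-y : x + d + y ≤ x ⁺ + (y + d) ⁺
    below-y = ≤-resp-≈ (solve 3 (λ x y d → x :+ (y :+ d) := x :+ d :+ y) ≈-refl x y d)
      ≈-refl (+-mono-≤ (x≤x⁺ x) (x≤x⁺ (y + d)))
    below-0 : x + d ≤ x ⁺ + (y + d) ⁺
    below-0 = ≤-trans (+-monoˡ-≤ d x≤y)
      (≤-resp-≈ (+-identityˡ _) ≈-refl (+-mono-≤ (0≤x⁺ x) (x≤x⁺ (y + d))))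
    y⁺-below : y ⁺ ≤ x ⁺ + (y + d) ⁺ - (x + d)
    y⁺-below = ⁺-least
      (≤-resp-≈ (solve 2 (λ a y → a :+ y :- a := y) ≈-refl (x + d) y) ≈-refl
        (+-monoˡ-≤ (- (x + d)) below-y))
      (x≤y⇒0≤y-x below-0)
    below : x + d ≤ x ⁺ + (y + d) ⁺ - y ⁺
    below = ≤-resp-≈
      (solve 2 (λ a b → b :+ (a :- b) := a) ≈-refl (x + d) (y ⁺))
      (solve 3 (λ a b s → s :- a :+ (a :- b) := s :- b) ≈-refl (x + d) (y ⁺) (x ⁺ + (y + d) ⁺))
      (+-monoˡ-≤ (x + d - y ⁺) y⁺-below)

-- Finite sums, and a common interface for upper and lower bounds.

module Summation {c ℓ₁ ℓ₂ ℓ₃} (ℛ : RealNumbers c ℓ₁ ℓ₂ ℓ₃) where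

  open RealNumbers ℛ
  open OrderedField ℛ
  open import Relation.Binary.Reasoning.Setoid setoid

  -- Sums over indices, letters and words are nested functionals; these laws are inherited under
  -- nesting, so each consequence is proved once for all of them.
  record IsSummation {A : Set} (∑ : (A → ℝ) → ℝ) : Set (c ⊔ ℓ₁ ⊔ ℓ₃) where
    field
      ∑-cong   : ∀ {f g} → (∀ x → f x ≈ g x) → ∑ f ≈ ∑ g
      ∑-+      : ∀ f g → ∑ (λ x → f x + g x) ≈ ∑ f + ∑ g
      ∑-*      : ∀ k f → ∑ (λ x → k * f x) ≈ k * ∑ f
      ∑-mono   : ∀ {f g} → (∀ x → f x ≤ g x) → ∑ f ≤ ∑ g
      ∑-single : ∀ {f} x → (∀ y → y ≢ x → f y ≈ 0#) → ∑ f ≈ f x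

    ∑-zero : ∀ {f} → (∀ x → f x ≈ 0#) → ∑ f ≈ 0#
    ∑-zero {f} f≈0 = begin
      ∑ f                ≈⟨ ∑-cong (λ x → ≈-trans (f≈0 x) (≈-sym (zeroˡ (f x)))) ⟩
      ∑ (λ x → 0# * f x) ≈⟨ ∑-* 0# f ⟩
      0# * ∑ f           ≈⟨ zeroˡ _ ⟩
      0#                 ∎

    ∑-sum : ∀ {n} (f : A → Vector ℝ n) →
            ∑ (λ x → sum (f x)) ≈ sum (λ i → ∑ (λ x → f x i))
    ∑-sum {zero}  f = ∑-zero (λ _ → ≈-refl)
    ∑-sum {suc n} f = ≈-trans (∑-+ _ _) (+-congˡ (∑-sum (λ x → f x ∘ fsuc)))

  open IsSummation

  sum-isSummation : ∀ {n} → IsSummation (sum {n})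
  sum-isSummation .∑-cong   = sum-cong-≋
  sum-isSummation .∑-+      = ∑-distrib-+
  sum-isSummation .∑-* k f  = ≈-sym (*-distribˡ-sum k f)
  sum-isSummation .∑-mono   = mono
    where
    mono : ∀ {n} {f g : Vector ℝ n} → (∀ i → f i ≤ g i) → sum f ≤ sum g
    mono {zero}  f≤g = ≤-refl
    mono {suc n} f≤g = +-mono-≤ (f≤g fzero) (mono (f≤g ∘ fsuc))
  sum-isSummation .∑-single = single
    where
    single : ∀ {n} {f : Vector ℝ n} i → (∀ j → j ≢ i → f j ≈ 0#) → sum f ≈ f i
    single {suc n} fzero f≈0 = ≈-trans
      (+-congˡ (≈-trans (sum-cong-≋ (λ j → f≈0 (fsuc j) λ ())) (sum-replicate-zero n)))
      (+-identityʳ _)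
    single {suc n} (fsuc i) f≈0 = ≈-trans
      (+-cong (f≈0 fzero λ ()) (single i λ j j≢i → f≈0 (fsuc j) (j≢i ∘ Finₚ.suc-injective)))
      (+-identityˡ _)

  Swaps : {A B : Set} → ((A → ℝ) → ℝ) → ((B → ℝ) → ℝ) → Set (c ⊔ ℓ₁)
  Swaps {A} {B} ∑₁ ∑₂ = ∀ (f : A → B → ℝ) → ∑₁ (λ x → ∑₂ (λ y → f x y)) ≈ ∑₂ (λ y → ∑₁ (λ x → f x y))

  module _ (m : ℕ) where
    open Theory ℛ m using (∑Vec; ∑𝓛; ∑Word; 𝓛; Word)

    ∑Vec-isSummation : ∀ {A : Set} {∑ : (A → ℝ) → ℝ} →
      IsSummation ∑ → ∀ n → IsSummation (∑Vec ∑ n)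
    ∑Vec-isSummation S zero = record
      { ∑-cong   = λ f≈g → f≈g []
      ; ∑-+      = λ _ _ → ≈-refl
      ; ∑-*      = λ _ _ → ≈-refl
      ; ∑-mono   = λ f≤g → f≤g []
      ; ∑-single = λ where [] _ → ≈-refl
      }
    ∑Vec-isSummation S (suc n) = record
      { ∑-cong   = λ f≈g → ∑-cong S λ x → ∑-cong T λ xs → f≈g (x ∷ xs)
      ; ∑-+      = λ f g → ≈-trans (∑-cong S λ x → ∑-+ T _ _) (∑-+ S _ _)
      ; ∑-*      = λ k f → ≈-trans (∑-cong S λ x → ∑-* T k _) (∑-* S k _)
      ; ∑-mono   = λ f≤g → ∑-mono S λ x → ∑-mono T λ xs → f≤g (x ∷ xs)
      ; ∑-single = λ where
          (x ∷ xs) f≈0 → ≈-trans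
            (∑-single S x λ y y≢x → ∑-zero T λ ys → f≈0 (y ∷ ys) (y≢x ∘ proj₁ ∘ ∷-injective))
            (∑-single T xs λ ys ys≢xs → f≈0 (x ∷ ys) (ys≢xs ∘ ∷-injectiveʳ))
      }
      where T = ∑Vec-isSummation S n

    ∑𝓛-isSummation : IsSummation ∑𝓛
    ∑𝓛-isSummation = ∑Vec-isSummation sum-isSummation m

    ∑Word-isSummation : ∀ {n} → IsSummation (∑Word {n})
    ∑Word-isSummation = ∑Vec-isSummation ∑𝓛-isSummation _

    -- A nested sum is passed one coordinate at a time, so exchanging with the one-coordinate sum is
    -- enough.
    swaps-∑Vec : ∀ {A B : Set} (∑₁ : (A → ℝ) → ℝ) (∑₂ : (B → ℝ) → ℝ) → IsSummation ∑₂ →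
      Swaps ∑₁ ∑₂ → ∀ n → Swaps ∑₁ (∑Vec ∑₂ n)
    swaps-∑Vec ∑₁ ∑₂ S swaps zero    f = ≈-refl
    swaps-∑Vec ∑₁ ∑₂ S swaps (suc n) f = ≈-trans (swaps _)
      (∑-cong S λ y → swaps-∑Vec ∑₁ ∑₂ S swaps n (λ x ys → f x (y ∷ ys)))

    ∑𝓛-∑Word-swap : ∀ {n} → Swaps ∑𝓛 (∑Word {n})
    ∑𝓛-∑Word-swap {n} = swaps-∑Vec ∑𝓛 ∑𝓛 ∑𝓛-isSummation
      (swaps-∑Vec ∑𝓛 sum sum-isSummation (∑-sum ∑𝓛-isSummation) m) n

  -- The upper and the lower bound are proved together, with ≼ standing for ≤ or ≥.
  record IsOrientation (_≼_ : Rel ℝ ℓ₃) : Set (lsuc 0ℓ ⊔ c ⊔ ℓ₁ ⊔ ℓ₃) where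
    field
      ≼-reflexive : ∀ {x y} → x ≈ y → x ≼ y
      ≼-trans     : ∀ {x y z} → x ≼ y → y ≼ z → x ≼ z
      *-monoˡ   : ∀ {z x y} → 0# ≤ z → x ≼ y → (z * x) ≼ (z * y)
      ∑-mono-≼  : ∀ {A : Set} {∑ : (A → ℝ) → ℝ} → IsSummation ∑ →
                  ∀ {f g} → (∀ x → f x ≼ g x) → ∑ f ≼ ∑ g

    resp-≈ : ∀ {x x′ y y′} → x ≈ x′ → y ≈ y′ → x ≼ y → x′ ≼ y′
    resp-≈ x≈x′ y≈y′ x≼y =
      ≼-trans (≼-reflexive (≈-sym x≈x′)) (≼-trans x≼y (≼-reflexive y≈y′))

  ≤-isOrientation : IsOrientation _≤_
  ≤-isOrientation = record
    { ≼-reflexive = ≤-reflexive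
    ; ≼-trans     = ≤-trans
    ; *-monoˡ    = *-monoˡ-≤
    ; ∑-mono-≼   = ∑-mono
    }

  ≥-isOrientation : IsOrientation (flip _≤_)
  ≥-isOrientation = record
    { ≼-reflexive = ≤-reflexive ∘ ≈-sym
    ; ≼-trans     = flip ≤-trans
    ; *-monoˡ    = *-monoˡ-≤
    ; ∑-mono-≼   = λ S → ∑-mono S
    }

-- Affine functions on the cube that support a truncated affine function.

module Affine {c ℓ₁ ℓ₂ ℓ₃} (ℛ : RealNumbers c ℓ₁ ℓ₂ ℓ₃) where

  open RealNumbers ℛ
  open OrderedField ℛ
  open Theory ℛ using (μ; ν; _∘𝓛_)
  open import Relation.Binary.Reasoning.Setoid setoid

  -- x plus the sum of the d k over the coordinates k with λ(k) = 0; this is the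
  -- form a₀ + ∑ aₖℓₖ takes when ℓₖ is replaced by (1 + ℓₖ)/2.
  affine : ∀ {m} → ℝ → Vector ℝ m → Vec (Fin 2) m → ℝ
  affine x d []               = x
  affine x d (fzero      ∷ l) = affine (x + d fzero) (d ∘ fsuc) l
  affine x d (fsuc fzero ∷ l) = affine x (d ∘ fsuc) l

  -- This is `(1 + ℓ) / 2` in terms of the sign `ℓ` of a bit.
  ind : Fin 2 → ℝ
  ind fzero        = 1#
  ind (fsuc fzero) = 0#

  -- The recursive form suits induction along the coordinates, the closed form suits permutations
  -- and expectations.
  affine≈sum : ∀ {m} x (d : Vector ℝ m) l →
               affine x d l ≈ x + sum (λ k → d k * ind (lookup l k))
  affine≈sum x d [] = ≈-sym (+-identityʳ x)
  affine≈sum x d (fzero ∷ l) = begin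
    affine (x + d fzero) (d ∘ fsuc) l ≈⟨ affine≈sum (x + d fzero) (d ∘ fsuc) l ⟩
    x + d fzero + s                   ≈⟨ +-assoc _ _ _ ⟩
    x + (d fzero + s)                 ≈⟨ +-congˡ (+-congʳ (*-identityʳ _)) ⟨
    x + (d fzero * 1# + s)            ∎
    where s = sum (λ k → d (fsuc k) * ind (lookup l k))
  affine≈sum x d (fsuc fzero ∷ l) = begin
    affine x (d ∘ fsuc) l             ≈⟨ affine≈sum x (d ∘ fsuc) l ⟩
    x + s                             ≈⟨ +-congˡ (+-identityˡ _) ⟨
    x + (0# + s)                      ≈⟨ +-congˡ (+-congʳ (zeroʳ _)) ⟨
    x + (d fzero * 0# + s)            ∎
    where s = sum (λ k → d (fsuc k) * ind (lookup l k))

  affine-monoˡ : ∀ {m x y} (d : Vector ℝ m) l → x ≤ y → affine x d l ≤ affine y d l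
  affine-monoˡ d []               x≤y = x≤y
  affine-monoˡ d (fzero      ∷ l) x≤y = affine-monoˡ (d ∘ fsuc) l (+-monoˡ-≤ (d fzero) x≤y)
  affine-monoˡ d (fsuc fzero ∷ l) x≤y = affine-monoˡ (d ∘ fsuc) l x≤y

  affine-congˡ : ∀ {m x y} (d : Vector ℝ m) l → x ≈ y → affine x d l ≈ affine y d l
  affine-congˡ d l x≈y = ≤-antisym (affine-monoˡ d l (≤-reflexive x≈y))
                                   (affine-monoˡ d l (≤-reflexive (≈-sym x≈y)))

  affine-permute : ∀ {m} (σ : Permutation′ m) x d l →
                   affine x (d ∘ (σ ⟨$⟩ʳ_)) (_∘𝓛_ m l σ) ≈ affine x d l
  affine-permute σ x d l = begin
    affine x (d ∘ (σ ⟨$⟩ʳ_)) (_∘𝓛_ _ l σ)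
      ≈⟨ affine≈sum x (d ∘ (σ ⟨$⟩ʳ_)) (_∘𝓛_ _ l σ) ⟩
    x + sum (λ k → d (σ ⟨$⟩ʳ k) * ind (lookup (_∘𝓛_ _ l σ) k))
      ≈⟨ +-congˡ (sum-cong-≋ λ k → *-congˡ (reflexive (≡.cong ind
           (lookup∘tabulate (λ k → lookup l (σ ⟨$⟩ʳ k)) k)))) ⟩
    x + sum (λ k → d (σ ⟨$⟩ʳ k) * ind (lookup l (σ ⟨$⟩ʳ k)))
      ≈⟨ +-congˡ (sum-permute (λ k → d k * ind (lookup l k)) σ) ⟨
    x + sum (λ k → d k * ind (lookup l k))
      ≈⟨ affine≈sum x d l ⟨
    affine x d l ∎

  -- Greedy increments of the truncation along the chain μ₀, μ₁, …, μₘ.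
  chainIncrement : ∀ {m} → ℝ → Vector ℝ m → Vector ℝ m
  chainIncrement x d fzero    = (x + d fzero) ⁺ - x ⁺
  chainIncrement x d (fsuc k) = chainIncrement (x + d fzero) (d ∘ fsuc) k

  ⁺-telescope : ∀ x y → x ⁺ + (y ⁺ - x ⁺) ≈ y ⁺
  ⁺-telescope x y = solve 2 (λ a b → a :+ (b :- a) := b) ≈-refl (x ⁺) (y ⁺)

  ⁺-step : ∀ {x y d} → x ≤ y → 0# ≤ d → (x + d) ⁺ ≤ x ⁺ + ((y + d) ⁺ - y ⁺)
  ⁺-step {x} {y} {d} x≤y 0≤d = ≤-resp-≈
    (≈-trans (+-comm _ _) (⁺-telescope x (x + d))) (+-comm _ _)
    (+-monoˡ-≤ (x ⁺) (⁺-increment x≤y 0≤d))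

  ⁺-step′ : ∀ {x y d} → x ≤ y → 0# ≤ d → y ⁺ + ((x + d) ⁺ - x ⁺) ≤ (y + d) ⁺
  ⁺-step′ {x} {y} {d} x≤y 0≤d = ≤-resp-≈
    (+-comm _ _) (≈-trans (+-comm _ _) (⁺-telescope y (y + d)))
    (+-monoˡ-≤ (y ⁺) (⁺-increment x≤y 0≤d))

  -- Here `x` follows the chain and takes every increment, while `y` follows `l` and takes only
  -- those at its zeros, so `y ≤ x` persists. By convexity an increment gains at most as much at `y`
  -- as at `x`.
  affine⁺≤chain : ∀ {m x y} (d : Vector ℝ m) → (∀ k → 0# ≤ d k) → y ≤ x →
                  ∀ l → affine y d l ⁺ ≤ affine (y ⁺) (chainIncrement x d) l
  affine⁺≤chain d 0≤d y≤x [] = ≤-refl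
  affine⁺≤chain {x = x} d 0≤d y≤x (fzero ∷ l) = ≤-trans
    (affine⁺≤chain (d ∘ fsuc) (0≤d ∘ fsuc) (+-monoˡ-≤ (d fzero) y≤x) l)
    (affine-monoˡ (chainIncrement (x + d fzero) (d ∘ fsuc)) l (⁺-step y≤x (0≤d fzero)))
  affine⁺≤chain d 0≤d y≤x (fsuc fzero ∷ l) =
    affine⁺≤chain (d ∘ fsuc) (0≤d ∘ fsuc) (≤-trans y≤x (x≤x+d (0≤d fzero))) l

  affine-μ₀ : ∀ {m} x (d : Vector ℝ m) → affine x d (μ m fzero) ≈ x
  affine-μ₀ {zero}  x d = ≈-refl
  affine-μ₀ {suc m} x d = affine-μ₀ x (d ∘ fsuc)

  -- The zeros of `μ i` form an initial segment, so the greedy increments taken along it telescope.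
  affine⁺≈chain : ∀ {m} x (d : Vector ℝ m) i →
                  affine x d (μ m i) ⁺ ≈ affine (x ⁺) (chainIncrement x d) (μ m i)
  affine⁺≈chain x d fzero = ≈-trans (⁺-cong (affine-μ₀ x d))
    (≈-sym (affine-μ₀ (x ⁺) (chainIncrement x d)))
  -- `μ (suc m) (fsuc i)` computes to `fzero ∷ μ m i`, so both sides unfold by one coordinate.
  affine⁺≈chain {suc m} x d (fsuc i) = ≈-trans
    (affine⁺≈chain (x + d fzero) (d ∘ fsuc) i)
    (affine-congˡ (chainIncrement x d ∘ fsuc) (μ m i) (≈-sym (⁺-telescope x (x + d fzero))))

  -- Each `ν (fsuc k)` differs from the centre `ν fzero` in one coordinate, so every increment
  -- starts at the same `x`.
  starIncrement : ∀ {m} → ℝ → Vector ℝ m → Vector ℝ m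
  starIncrement x d k = (x + d k) ⁺ - x ⁺

  -- The base `x` stays fixed while `y` grows with the zeros of `l`; by convexity every gain at `y`
  -- is at least the gain recorded at `x`.
  star≤affine⁺ : ∀ {m x y} (d : Vector ℝ m) → (∀ k → 0# ≤ d k) → x ≤ y →
                 ∀ l → affine (y ⁺) (starIncrement x d) l ≤ affine y d l ⁺
  star≤affine⁺ d 0≤d x≤y [] = ≤-refl
  star≤affine⁺ {x = x} d 0≤d x≤y (fzero ∷ l) = ≤-trans
    (affine-monoˡ (starIncrement x (d ∘ fsuc)) l (⁺-step′ x≤y (0≤d fzero)))
    (star≤affine⁺ (d ∘ fsuc) (0≤d ∘ fsuc) (≤-trans x≤y (x≤x+d (0≤d fzero))) l)
  star≤affine⁺ d 0≤d x≤y (fsuc fzero ∷ l) = star≤affine⁺ (d ∘ fsuc) (0≤d ∘ fsuc) x≤y l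

  affine-ν₀ : ∀ {m} x (d : Vector ℝ m) → affine x d (ν m fzero) ≈ x
  affine-ν₀ {zero}  x d = ≈-refl
  affine-ν₀ {suc m} x d = affine-ν₀ x (d ∘ fsuc)

  affine-ν : ∀ {m} x (d : Vector ℝ m) k → affine x d (ν m (fsuc k)) ≈ x + d k
  affine-ν x d fzero    = affine-ν₀ (x + d fzero) (d ∘ fsuc)
  affine-ν x d (fsuc k) = affine-ν x (d ∘ fsuc) k

  affine⁺≈star : ∀ {m} x (d : Vector ℝ m) i →
                 affine x d (ν m i) ⁺ ≈ affine (x ⁺) (starIncrement x d) (ν m i)
  affine⁺≈star x d fzero = ≈-trans (⁺-cong (affine-ν₀ x d))
    (≈-sym (affine-ν₀ (x ⁺) (starIncrement x d)))
  affine⁺≈star x d (fsuc k) = ≈-trans (⁺-cong (affine-ν x d k))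
    (≈-sym (≈-trans (affine-ν (x ⁺) (starIncrement x d) k) (⁺-telescope x (x + d k))))

-- Weights of the supervertex and of the subvertex.

module Vertices {c ℓ₁ ℓ₂ ℓ₃} (ℛ : RealNumbers c ℓ₁ ℓ₂ ℓ₃) where

  open RealNumbers ℛ hiding (zero)
  open OrderedField ℛ
  open Affine ℛ
  open Summation ℛ using (module IsSummation; sum-isSummation)
  open Theory ℛ using (μ; ν; b″)
  open IsSummation using (∑-single)
  open import Relation.Binary.Reasoning.Setoid setoid

  -- The weights b′, started from an arbitrary y in place of b(0) = 1 so that
  -- they can be handled by induction on m.
  chainWeight : ∀ {m} → ℝ → Vector ℝ m → Vector ℝ (suc m)
  chainWeight {zero}  y b _        = half (y - - 1#)
  chainWeight {suc m} y b fzero    = half (y - b fzero)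
  chainWeight {suc m} y b (fsuc i) = chainWeight (b fzero) (b ∘ fsuc) i

  -- Splits off the first entry so that the rest is again a vector with `v` appended, the shape that
  -- the recursion in `chainWeight≈` needs.
  insertAt-last : ∀ {m} (b : Vector ℝ (suc m)) v j →
    insertAt b (Fin.fromℕ (suc m)) v j ≡ (b fzero Vector.∷ insertAt (b ∘ fsuc) (Fin.fromℕ m) v) j
  insertAt-last b v fzero    = ≡.refl
  insertAt-last b v (fsuc j) = ≡.refl

  chainWeight≈ : ∀ {m} y (b : Vector ℝ m) i → let b+ = insertAt b (Fin.fromℕ m) (- 1#) in
    half ((y Vector.∷ b+) (inject₁ i) - b+ i) ≈ chainWeight y b i
  chainWeight≈ {zero}  y b fzero    = ≈-refl
  chainWeight≈ {suc m} y b fzero    = ≈-refl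
  chainWeight≈ {suc m} y b (fsuc i) = ≈-trans
    (*-congʳ (+-congʳ (reflexive (insertAt-last b (- 1#) (inject₁ i)))))
    (chainWeight≈ (b fzero) (b ∘ fsuc) i)

  half-nonneg : ∀ {x y} → x ≤ y → 0# ≤ half (y - x)
  half-nonneg x≤y = *-nonneg (x≤y⇒0≤y-x x≤y) 0≤½

  -- In the recursive call `b fzero` replaces `y`; it bounds the later entries because `b` is
  -- decreasing.
  chainWeight-nonneg : ∀ {m} y (b : Vector ℝ m) → Theory.Decreasing ℛ m b → - 1# ≤ y →
    (∀ j → (- 1# ≤ b j) × (b j ≤ y)) → ∀ i → 0# ≤ chainWeight y b i
  chainWeight-nonneg {zero}  y b b↓ -1≤y b∈ i = half-nonneg -1≤y
  chainWeight-nonneg {suc m} y b b↓ -1≤y b∈ fzero = half-nonneg (proj₂ (b∈ fzero))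
  chainWeight-nonneg {suc m} y b b↓ -1≤y b∈ (fsuc i) =
    chainWeight-nonneg (b fzero) (b ∘ fsuc) (λ i≤j → b↓ (ℕ.s≤s i≤j)) (proj₁ (b∈ fzero))
      (λ j → proj₁ (b∈ (fsuc j)) , b↓ z≤n) i

  -- The differences telescope from `y` down to the final `- 1#`.
  sum-chainWeight : ∀ {m} y (b : Vector ℝ m) → sum (chainWeight y b) ≈ half (y + 1#)
  sum-chainWeight {zero} y b =
    solve 2 (λ y h → (y :- :- con (+ 1)) :* h :+ con (+ 0) := (y :+ con (+ 1)) :* h) ≈-refl y ½
  sum-chainWeight {suc m} y b = ≈-trans
    (+-congˡ (sum-chainWeight (b fzero) (b ∘ fsuc)))
    (solve 3 (λ y z h → (y :- z) :* h :+ (z :+ con (+ 1)) :* h := (y :+ con (+ 1)) :* h)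
      ≈-refl y (b fzero) ½)

  lookup-μ₀ : ∀ {m} j → lookup (μ m fzero) j ≡ fsuc fzero
  lookup-μ₀ {suc m} fzero    = ≡.refl
  lookup-μ₀ {suc m} (fsuc j) = lookup-μ₀ {m} j

  *-ind-one : ∀ {x s} → s ≡ fsuc fzero → x * ind s ≈ 0#
  *-ind-one {x} s≡1 = ≈-trans (*-congˡ (reflexive (≡.cong ind s≡1))) (zeroʳ x)

  -- Coordinate `j` is zero exactly on the later part of the chain, so the sum is a tail of the
  -- weights, which telescopes from `b j`.
  chainWeight-marginal : ∀ {m} y (b : Vector ℝ m) j →
    sum (λ i → chainWeight y b i * ind (lookup (μ m i) j)) ≈ half (b j + 1#)
  chainWeight-marginal {suc m} y b fzero = begin
    half (y - b fzero) * 0# + sum (λ i → chainWeight (b fzero) (b ∘ fsuc) i * 1#)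
      ≈⟨ +-cong (zeroʳ _) (sum-cong-≋ λ i → *-identityʳ (chainWeight (b fzero) (b ∘ fsuc) i)) ⟩
    0# + sum (chainWeight (b fzero) (b ∘ fsuc))
      ≈⟨ +-identityˡ _ ⟩
    sum (chainWeight (b fzero) (b ∘ fsuc))
      ≈⟨ sum-chainWeight (b fzero) (b ∘ fsuc) ⟩
    half (b fzero + 1#) ∎
  chainWeight-marginal {suc m} y b (fsuc j) = ≈-trans
    (+-cong (*-ind-one (lookup-μ₀ {m} j)) (chainWeight-marginal (b fzero) (b ∘ fsuc) j))
    (+-identityˡ _)

  lookup-ν : ∀ {m} i j → lookup (ν m i) j ≡ (if does (i Finₚ.≟ fsuc j) then fzero else fsuc fzero)
  lookup-ν i j = lookup∘tabulate (λ j → if does (i Finₚ.≟ fsuc j) then fzero else fsuc fzero) j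

  lookup-ν-same : ∀ {m} j → lookup (ν m (fsuc j)) j ≡ fzero
  lookup-ν-same j = ≡.trans (lookup-ν (fsuc j) j)
    (≡.cong (if_then fzero else fsuc fzero) (dec-true (fsuc j Finₚ.≟ fsuc j) ≡.refl))

  lookup-ν-other : ∀ {m} i j → i ≢ fsuc j → lookup (ν m i) j ≡ fsuc fzero
  lookup-ν-other i j i≢j = ≡.trans (lookup-ν i j)
    (≡.cong (if_then fzero else fsuc fzero) (dec-false (i Finₚ.≟ fsuc j) i≢j))

  ν-suc≢ν₀ : ∀ {m} j → ν m (fsuc j) ≢ ν m fzero
  ν-suc≢ν₀ {m} j eq with () ← ≡.trans (≡.sym (lookup-ν-same j))
    (≡.trans (≡.cong (λ l → lookup l j) eq) (lookup-ν-other fzero j λ ()))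

  module _ {m : ℕ} (b : Vector ℝ m) where

    sum-b″ : sum (b″ m b) ≈ 1#
    sum-b″ = solve 1 (λ s → (con (+ 1) :- s) :+ s := con (+ 1)) ≈-refl (sum (λ i → half (b i + 1#)))

    -- Only `ν (fsuc j)` has a zero at `j`, so a single weight survives.
    b″-marginal : ∀ j → sum (λ i → b″ m b i * ind (lookup (ν m i) j)) ≈ half (b j + 1#)
    b″-marginal j = begin
      sum (λ i → b″ m b i * ind (lookup (ν m i) j))
        ≈⟨ ∑-single sum-isSummation (fsuc j) (λ i i≢j → *-ind-one {b″ m b i} (lookup-ν-other i j i≢j)) ⟩
      b″ m b (fsuc j) * ind (lookup (ν m (fsuc j)) j)
        ≈⟨ *-congˡ (reflexive (≡.cong ind (lookup-ν-same j))) ⟩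
      b″ m b (fsuc j) * 1#
        ≈⟨ *-identityʳ _ ⟩
      half (b j + 1#) ∎

    b″₀≈ : b″ m b fzero ≈ 1# - half (sum b + fromℕ m)
    b″₀≈ = +-congˡ (-‿cong (begin
      sum (λ i → half (b i + 1#))       ≈⟨ *-distribʳ-sum ½ (λ i → b i + 1#) ⟨
      sum (λ i → b i + 1#) * ½            ≈⟨ *-congʳ (∑-distrib-+ b (λ _ → 1#)) ⟩
      (sum b + sum (λ (_ : Fin m) → 1#)) * ½  ≈⟨ *-congʳ (+-congˡ (sum-replicate m)) ⟩
      half (sum b + fromℕ m)            ∎))

    -- The right side minus the left side is `2 / m` times `b″ m b fzero`, and multiplying by
    -- `m / 2` recovers that weight.
    b″₀-nonneg⇔ : .{{_ : NonZero m}} → (0# ≤ b″ m b fzero) ⇔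
      (1# ÷ fromℕ m [ fromℕ-pos m ] * sum b ≤ fromℕ 2 ÷ fromℕ m [ fromℕ-pos m ] - 1#)
    b″₀-nonneg⇔ = mk⇔
      (λ 0≤b″₀ → 0≤y-x⇒x≤y (≤-resp-≈ ≈-refl (≈-sym gap≈)
        (*-nonneg (≤-resp-≈ (+-identityʳ 0#) ≈-refl (+-mono-≤ 0≤r 0≤r)) 0≤b″₀)))
      (λ lhs≤rhs → ≤-resp-≈ ≈-refl b″₀≈scaled-gap
        (*-nonneg (*-nonneg (<⇒≤ (fromℕ-pos m)) 0≤½) (x≤y⇒0≤y-x lhs≤rhs)))
      where
      r = recip (fromℕ-pos m)
      0≤r = recip-nonneg (fromℕ-pos m)
      rM≈1 = recip-inverse (fromℕ-pos m)
      lhs = 1# * r * sum b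
      rhs = fromℕ 2 * r - 1#
      gap≈ : rhs - lhs ≈ (r + r) * b″ m b fzero
      gap≈ = begin
        fromℕ 2 * r - 1# - 1# * r * sum b
          -- Writing `1#` as `r * fromℕ m` here, and as `½ + ½` further down, leaves only polynomial
          -- identities.
          ≈⟨ +-congʳ (+-congˡ (-‿cong rM≈1)) ⟨
        fromℕ 2 * r - r * fromℕ m - 1# * r * sum b
          ≈⟨ solve 3 (λ r M S → (con (+ 1) :+ (con (+ 1) :+ con (+ 0))) :* r :- r :* M :- con (+ 1) :* r :* S
               := (r :+ r) :- con (+ 1) :* (r :* (S :+ M))) ≈-refl r (fromℕ m) (sum b) ⟩
        (r + r) - 1# * (r * (sum b + fromℕ m))
          ≈⟨ +-congˡ (-‿cong (*-congʳ ½+½≈1)) ⟨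
        (r + r) - (½ + ½) * (r * (sum b + fromℕ m))
          ≈⟨ solve 4 (λ r M S h → (r :+ r) :- (h :+ h) :* (r :* (S :+ M))
               := (r :+ r) :* (con (+ 1) :- (S :+ M) :* h)) ≈-refl r (fromℕ m) (sum b) ½ ⟩
        (r + r) * (1# - half (sum b + fromℕ m))
          ≈⟨ *-congˡ b″₀≈ ⟨
        (r + r) * b″ m b fzero ∎
      b″₀≈scaled-gap : fromℕ m * ½ * (rhs - lhs) ≈ b″ m b fzero
      b″₀≈scaled-gap = begin
        fromℕ m * ½ * (rhs - lhs)
          ≈⟨ *-congˡ gap≈ ⟩
        fromℕ m * ½ * ((r + r) * b″ m b fzero)
          ≈⟨ solve 4 (λ M h r x → M :* h :* ((r :+ r) :* x) := (h :+ h) :* (r :* M) :* x)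
               ≈-refl (fromℕ m) ½ r (b″ m b fzero) ⟩
        (½ + ½) * (r * fromℕ m) * b″ m b fzero
          ≈⟨ *-congʳ (*-cong ½+½≈1 rM≈1) ⟩
        1# * 1# * b″ m b fzero
          ≈⟨ *-congʳ (*-identityˡ 1#) ⟩
        1# * b″ m b fzero
          ≈⟨ *-identityˡ _ ⟩
        b″ m b fzero ∎

-- One-step optimality of the supervertex and of the subvertex.

module Dominance {c ℓ₁ ℓ₂ ℓ₃} (ℛ : RealNumbers c ℓ₁ ℓ₂ ℓ₃) (m : ℕ) where

  open RealNumbers ℛ hiding (zero)
  open OrderedField ℛ hiding (_⁺; half)
  open Summation ℛ
  open IsSummation
  open IsOrientation
  open Affine ℛ
  open Vertices ℛ
  open Theory ℛ m
  open import Relation.Binary.Reasoning.Setoid setoid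

  e-diagonal : ∀ l → e l l ≈ 1#
  e-diagonal l = reflexive (≡.cong (if_then 1# else 0#) (dec-true (l ≟𝓛 l) ≡.refl))

  e-off-diagonal : ∀ {l l′} → l ≢ l′ → e l l′ ≈ 0#
  e-off-diagonal {l} {l′} l≢l′ =
    reflexive (≡.cong (if_then 1# else 0#) (dec-false (l ≟𝓛 l′) l≢l′))

  e-nonneg : ∀ l l′ → 0# ≤ e l l′
  e-nonneg l l′ with does (l ≟𝓛 l′)
  ... | true  = 0≤1
  ... | false = ≤-refl

  e-cong : ∀ {k k′ l l′} → (k ≡ k′ → l ≡ l′) → (l ≡ l′ → k ≡ k′) → e k k′ ≈ e l l′
  e-cong {k} {k′} {l} {l′} to from = reflexive (≡.cong (if_then 1# else 0#)
    (does-⇔ (mk⇔ to from) (k ≟𝓛 k′) (l ≟𝓛 l′)))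

  ∑𝓛-e : ∀ l (f : 𝓛 → ℝ) → ∑𝓛 (λ l′ → e l l′ * f l′) ≈ f l
  ∑𝓛-e l f = begin
    ∑𝓛 (λ l′ → e l l′ * f l′) ≈⟨ ∑-single (∑𝓛-isSummation m) l (λ l′ l′≢l →
                                   ≈-trans (*-congʳ (e-off-diagonal (l′≢l ∘ ≡.sym))) (zeroˡ (f l′))) ⟩
    e l l * f l               ≈⟨ *-congʳ (e-diagonal l) ⟩
    1# * f l                  ≈⟨ *-identityˡ (f l) ⟩
    f l                       ∎

  ⟨⟩-congʳ : ∀ q {f g} → (∀ l → f l ≈ g l) → ⟨ q , f ⟩ ≈ ⟨ q , g ⟩
  ⟨⟩-congʳ q f≈g = ∑-cong (∑𝓛-isSummation m) (λ l → *-congˡ (f≈g l))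

  ⟨⟩-comm : ∀ f g → ⟨ f , g ⟩ ≈ ⟨ g , f ⟩
  ⟨⟩-comm f g = ∑-cong (∑𝓛-isSummation m) (λ l → *-comm (f l) (g l))

  ⟨⟩-+ : ∀ q f g → ⟨ q , (λ l → f l + g l) ⟩ ≈ ⟨ q , f ⟩ + ⟨ q , g ⟩
  ⟨⟩-+ q f g = ≈-trans (∑-cong (∑𝓛-isSummation m) (λ l → distribˡ (q l) (f l) (g l)))
    (∑-+ (∑𝓛-isSummation m) _ _)

  ⟨⟩-* : ∀ q k f → ⟨ q , (λ l → k * f l) ⟩ ≈ k * ⟨ q , f ⟩
  ⟨⟩-* q k f = ≈-trans
    (∑-cong (∑𝓛-isSummation m) (λ l →
      solve 3 (λ q k f → q :* (k :* f) := k :* (q :* f)) ≈-refl (q l) k (f l)))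
    (∑-* (∑𝓛-isSummation m) k _)

  ⟨⟩-sum : ∀ q {n} (f : Fin n → 𝓛 → ℝ) →
           ⟨ q , (λ l → sum (λ i → f i l)) ⟩ ≈ sum (λ i → ⟨ q , f i ⟩)
  ⟨⟩-sum q f = ≈-trans
    (∑-cong (∑𝓛-isSummation m) (λ l → *-distribˡ-sum (q l) (λ i → f i l)))
    (∑-sum (∑𝓛-isSummation m) (λ l i → q l * f i l))

  ⟨⟩-mono : ∀ {_≼_} → IsOrientation _≼_ → ∀ {q f g} → (∀ l → 0# ≤ q l) →
            (∀ l → f l ≼ g l) → ⟨ q , f ⟩ ≼ ⟨ q , g ⟩
  ⟨⟩-mono O 0≤q f≼g = ∑-mono-≼ O (∑𝓛-isSummation m) (λ l → *-monoˡ O (0≤q l) (f≼g l))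

  -- A combination of point masses at the letters `κ i`, with weights of any sign.
  record Mixture {n} (w : Vector ℝ n) (κ : Fin n → 𝓛) (q : 𝓛 → ℝ) : Set ℓ₁ where
    constructor mixture
    field expand : ∀ l → q l ≈ sum (λ i → w i * e (κ i) l)

  open Mixture

  mixture-⟨⟩ : ∀ {n} {w : Vector ℝ n} {κ q} → Mixture w κ q →
               ∀ f → ⟨ q , f ⟩ ≈ sum (λ i → w i * f (κ i))
  mixture-⟨⟩ {w = w} {κ} {q} mix f = begin
    ⟨ q , f ⟩                               ≈⟨ ⟨⟩-comm q f ⟩
    ⟨ f , q ⟩                               ≈⟨ ⟨⟩-congʳ f (expand mix) ⟩
    ⟨ f , (λ l → sum (λ i → w i * e (κ i) l)) ⟩
                                            ≈⟨ ⟨⟩-sum f (λ i l → w i * e (κ i) l) ⟩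
    sum (λ i → ⟨ f , (λ l → w i * e (κ i) l) ⟩)
                                            ≈⟨ sum-cong-≋ (λ i → ⟨⟩-* f (w i) (e (κ i))) ⟩
    sum (λ i → w i * ⟨ f , e (κ i) ⟩)       ≈⟨ sum-cong-≋ (λ i → *-congˡ {w i}
                                                 (≈-trans (⟨⟩-comm f (e (κ i))) (∑𝓛-e (κ i) f))) ⟩
    sum (λ i → w i * f (κ i))               ∎

  coordinate : Fin m → 𝓛 → ℝ
  coordinate k l = ind (lookup l k)

  -- The constant appears as `ℓ fzero`, whose pairing with a density is the total mass, so the
  -- identity passes to pairings by linearity.
  ℓ≈coordinate : ∀ k l → ℓ (fsuc k) l ≈ (1# + 1#) * coordinate k l + - 1# * ℓ fzero l
  ℓ≈coordinate k l with lookup l k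
  ... | fzero      = solve 0 (con (+ 1) := (con (+ 1) :+ con (+ 1)) :* con (+ 1) :+ :- con (+ 1) :* con (+ 1)) ≈-refl
  -- The power `(- 1#) ^ 1` unfolds to `- 1# * 1#`, hence the unsimplified left side.
  ... | fsuc fzero = solve 0 (:- con (+ 1) :* con (+ 1) := (con (+ 1) :+ con (+ 1)) :* con (+ 0) :+ :- con (+ 1) :* con (+ 1)) ≈-refl

  ⟨⟩-ℓ : ∀ q k → ⟨ q , ℓ (fsuc k) ⟩ ≈ (1# + 1#) * ⟨ q , coordinate k ⟩ + - 1# * ⟨ q , ℓ fzero ⟩
  ⟨⟩-ℓ q k = begin
    ⟨ q , ℓ (fsuc k) ⟩
      ≈⟨ ⟨⟩-congʳ q (ℓ≈coordinate k) ⟩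
    ⟨ q , (λ l → (1# + 1#) * coordinate k l + - 1# * ℓ fzero l) ⟩
      ≈⟨ ⟨⟩-+ q (λ l → (1# + 1#) * coordinate k l) (λ l → - 1# * ℓ fzero l) ⟩
    ⟨ q , (λ l → (1# + 1#) * coordinate k l) ⟩ + ⟨ q , (λ l → - 1# * ℓ fzero l) ⟩
      ≈⟨ +-cong (⟨⟩-* q (1# + 1#) (coordinate k)) (⟨⟩-* q (- 1#) (ℓ fzero)) ⟩
    (1# + 1#) * ⟨ q , coordinate k ⟩ + - 1# * ⟨ q , ℓ fzero ⟩ ∎

  total-mass : ∀ {b q} → q ∈ Polytope b → ⟨ q , ℓ fzero ⟩ ≈ 1#
  total-mass {q = q} (_ , q₀ , _) = ≈-trans (⟨⟩-comm q (ℓ fzero)) q₀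

  marginal : ∀ {b q} → q ∈ Polytope b → ∀ k → ⟨ q , coordinate k ⟩ ≈ half (b k + 1#)
  marginal {b} {q} q∈@(_ , _ , qₖ) k = begin
    x
      ≈⟨ *-identityˡ x ⟨
    1# * x
      ≈⟨ *-congʳ ½+½≈1 ⟨
    (½ + ½) * x
      ≈⟨ solve 2 (λ h x → (h :+ h) :* x
           := ((con (+ 1) :+ con (+ 1)) :* x :+ :- con (+ 1) :* con (+ 1) :+ con (+ 1)) :* h) ≈-refl ½ x ⟩
    half ((1# + 1#) * x + - 1# * 1# + 1#)
      ≈⟨ *-congʳ (+-congʳ (+-congˡ (*-congˡ (total-mass {b} q∈)))) ⟨
    half ((1# + 1#) * x + - 1# * ⟨ q , ℓ fzero ⟩ + 1#)
      ≈⟨ *-congʳ (+-congʳ (⟨⟩-ℓ q k)) ⟨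
    half (⟨ q , ℓ (fsuc k) ⟩ + 1#)
      ≈⟨ *-congʳ (+-congʳ (≈-trans (⟨⟩-comm q (ℓ (fsuc k))) (qₖ k))) ⟩
    half (b k + 1#) ∎
    where x = ⟨ q , coordinate k ⟩

  -- The right side depends on `b` but not on `q`: all elements of `Polytope b` give an affine
  -- function the same expectation.
  ⟨⟩-affine : ∀ {b q} → q ∈ Polytope b → ∀ x d →
              ⟨ q , affine x d ⟩ ≈ x + sum (λ k → d k * half (b k + 1#))
  ⟨⟩-affine {b} {q} q∈ x d = begin
    ⟨ q , affine x d ⟩
      ≈⟨ ⟨⟩-congʳ q (λ l → ≈-trans (affine≈sum x d l) (+-congʳ (≈-sym (*-identityʳ x)))) ⟩
    ⟨ q , (λ l → x * ℓ fzero l + sum (λ k → d k * coordinate k l)) ⟩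
      ≈⟨ ⟨⟩-+ q (λ l → x * ℓ fzero l) (λ l → sum (λ k → d k * coordinate k l)) ⟩
    ⟨ q , (λ l → x * ℓ fzero l) ⟩ + ⟨ q , (λ l → sum (λ k → d k * coordinate k l)) ⟩
      ≈⟨ +-cong (⟨⟩-* q x (ℓ fzero)) (⟨⟩-sum q (λ k l → d k * coordinate k l)) ⟩
    x * ⟨ q , ℓ fzero ⟩ + sum (λ k → ⟨ q , (λ l → d k * coordinate k l) ⟩)
      ≈⟨ +-cong (≈-trans (*-congˡ (total-mass {b} q∈)) (*-identityʳ x))
           (sum-cong-≋ λ k → ≈-trans (⟨⟩-* q (d k) (coordinate k)) (*-congˡ (marginal {b} q∈ k))) ⟩
    x + sum (λ k → d k * half (b k + 1#)) ∎

  mixture∈Polytope : ∀ {b n} {w : Vector ℝ n} {κ q} → Mixture w κ q → (∀ i → 0# ≤ w i) →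
    sum w ≈ 1# → (∀ k → sum (λ i → w i * coordinate k (κ i)) ≈ half (b k + 1#)) → q ∈ Polytope b
  mixture∈Polytope {b} {n} {w} {κ} {q} mix 0≤w ∑w≈1 marg =
    (λ l → ≤-resp-≈ (sum-replicate-zero n) (≈-sym (expand mix l))
       (∑-mono (sum-isSummation) (λ i → *-nonneg (0≤w i) (e-nonneg (κ i) l)))) ,
    ≈-trans (⟨⟩-comm (ℓ fzero) q) mass ,
    λ k → ≈-trans (⟨⟩-comm (ℓ (fsuc k)) q) (begin
      ⟨ q , ℓ (fsuc k) ⟩
        ≈⟨ ⟨⟩-ℓ q k ⟩
      (1# + 1#) * ⟨ q , coordinate k ⟩ + - 1# * ⟨ q , ℓ fzero ⟩
        ≈⟨ +-cong (*-congˡ (≈-trans (mixture-⟨⟩ mix (coordinate k)) (marg k))) (*-congˡ mass) ⟩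
      (1# + 1#) * half (b k + 1#) + - 1# * 1#
        ≈⟨ solve 2 (λ b h → (con (+ 1) :+ con (+ 1)) :* ((b :+ con (+ 1)) :* h) :+ :- con (+ 1) :* con (+ 1)
             := (b :+ con (+ 1)) :* (h :+ h) :- con (+ 1)) ≈-refl (b k) ½ ⟩
      (b k + 1#) * (½ + ½) - 1#
        ≈⟨ +-congʳ (*-congˡ ½+½≈1) ⟩
      (b k + 1#) * 1# - 1#
        ≈⟨ solve 1 (λ b → (b :+ con (+ 1)) :* con (+ 1) :- con (+ 1) := b) ≈-refl (b k) ⟩
      b k ∎)
    where
    mass : ⟨ q , ℓ fzero ⟩ ≈ 1#
    mass = begin
      ⟨ q , ℓ fzero ⟩     ≈⟨ mixture-⟨⟩ mix (ℓ fzero) ⟩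
      sum (λ i → w i * 1#) ≈⟨ sum-cong-≋ (λ i → *-identityʳ (w i)) ⟩
      sum w               ≈⟨ ∑w≈1 ⟩
      1#                  ∎

  -- Substituting `2 * coordinate - 1` for each sign doubles the slopes and moves their original sum
  -- `s` into the constant.
  Uℓ-pos⇒affine : ∀ {u} → u ∈ Uℓ-pos →
    ∃[ x ] ∃[ d ] (∀ k → 0# ≤ d k) × (∀ l → u l ≈ affine x d l)
  Uℓ-pos⇒affine {u} (a , 0<a , u≈) = a fzero - s , d , 0≤d , u≈affine
    where
    a₊ d : Vector ℝ m
    a₊ k = a (fsuc k)
    d k = a₊ k * (1# + 1#)
    s = sum a₊
    0≤d : ∀ k → 0# ≤ d k
    0≤d k = *-nonneg (<⇒≤ (0<a k)) (≤-resp-≈ (+-identityˡ 0#) ≈-refl (+-mono-≤ 0≤1 0≤1))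
    u≈affine : ∀ l → u l ≈ affine (a fzero - s) d l
    u≈affine l = begin
      u l
        ≈⟨ u≈ l ⟩
      a fzero * 1# + sum (λ k → a₊ k * ℓ (fsuc k) l)
        ≈⟨ +-congˡ (sum-cong-≋ λ k → ≈-trans (*-congˡ (ℓ≈coordinate k l))
             (solve 2 (λ a x → a :* ((con (+ 1) :+ con (+ 1)) :* x :+ :- con (+ 1) :* con (+ 1))
               := a :* (con (+ 1) :+ con (+ 1)) :* x :+ :- con (+ 1) :* a) ≈-refl (a₊ k) (coordinate k l))) ⟩
      a fzero * 1# + sum (λ k → d k * coordinate k l + - 1# * a₊ k)
        ≈⟨ +-congˡ (∑-distrib-+ (λ k → d k * coordinate k l) (λ k → - 1# * a₊ k)) ⟩
      a fzero * 1# + (sum (λ k → d k * coordinate k l) + sum (λ k → - 1# * a₊ k))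
        ≈⟨ +-congˡ (+-congˡ (*-distribˡ-sum (- 1#) a₊)) ⟨
      a fzero * 1# + (sum (λ k → d k * coordinate k l) + - 1# * s)
        ≈⟨ solve 3 (λ a x s → a :* con (+ 1) :+ (x :+ :- con (+ 1) :* s) := a :- s :+ x)
             ≈-refl (a fzero) (sum (λ k → d k * coordinate k l)) s ⟩
      a fzero - s + sum (λ k → d k * coordinate k l)
        ≈⟨ affine≈sum (a fzero - s) d l ⟨
      affine (a fzero - s) d l ∎

  Uℓ-pos⁺-resp-≈ : ∀ {v v′} → (∀ l → v l ≈ v′ l) → v ∈ Uℓ-pos⁺ → v′ ∈ Uℓ-pos⁺
  Uℓ-pos⁺-resp-≈ v≈v′ (k , u , u∈ , v≈) = k , u , u∈ , λ l → ≈-trans (≈-sym (v≈v′ l)) (v≈ l)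

  -- An affine majorant, or minorant for the reversed order, with contact at the points `κ i`. It
  -- serves as a dual certificate that mass on these points is optimal.
  Supporting : ∀ {n} → Rel ℝ ℓ₃ → (Fin n → 𝓛) → Set _
  Supporting _≼_ κ = ∀ x d → (∀ k → 0# ≤ d k) → ∃[ x′ ] ∃[ d′ ]
    (∀ l → (affine x d l ⁺) ≼ affine x′ d′ l) ×
    (∀ i → affine x d (κ i) ⁺ ≈ affine x′ d′ (κ i))

  Dominates : Rel ℝ ℓ₃ → Vector ℝ m → (𝓛 → ℝ) → Set _
  Dominates _≼_ b q = ∀ {p v} → p ∈ Polytope b → v ∈ Uℓ-pos⁺ → ⟨ p , v ⟩ ≼ ⟨ q , v ⟩

  -- For each truncated summand, the expectation under `p` is bounded by that of the supporting
  -- affine function. The latter is the same under `q`, which lives on the contact points, where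
  -- function and summand agree.
  supporting⇒dominates : ∀ {_≼_} → IsOrientation _≼_ →
    ∀ {b q n} {w : Vector ℝ n} {κ} → q ∈ Polytope b → Mixture w κ q →
    Supporting _≼_ κ → Dominates _≼_ b q
  supporting⇒dominates {_≼_} O {b} {q} {w = w} {κ} q∈ mix support {p} {v} p∈ (k , u , u∈ , v≈) =
    resp-≈ O (≈-sym (split p)) (≈-sym (split q)) (∑-mono-≼ O sum-isSummation termwise)
    where
    split : ∀ r → ⟨ r , v ⟩ ≈ sum (λ i → ⟨ r , (λ l → u i l ⁺) ⟩)
    split r = ≈-trans (⟨⟩-congʳ r v≈) (⟨⟩-sum r (λ i l → u i l ⁺))
    termwise : ∀ i → ⟨ p , (λ l → u i l ⁺) ⟩ ≼ ⟨ q , (λ l → u i l ⁺) ⟩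
    termwise i with x , d , 0≤d , u≈ ← Uℓ-pos⇒affine (u∈ i)
               with x′ , d′ , below , touch ← support x d 0≤d = ≼-trans O
      (⟨⟩-mono O (proj₁ p∈) (λ l → ≼-trans O (≼-reflexive O (⁺-cong (u≈ l))) (below l)))
      (≼-reflexive O (begin
        ⟨ p , affine x′ d′ ⟩                ≈⟨ ⟨⟩-affine p∈ x′ d′ ⟩
        x′ + sum (λ k → d′ k * half (b k + 1#)) ≈⟨ ⟨⟩-affine q∈ x′ d′ ⟨
        ⟨ q , affine x′ d′ ⟩                ≈⟨ mixture-⟨⟩ mix (affine x′ d′) ⟩
        sum (λ j → w j * affine x′ d′ (κ j)) ≈⟨ sum-cong-≋ (λ j → *-congˡ {w j}
                                                 (≈-trans (⁺-cong (u≈ (κ j))) (touch j))) ⟨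
        sum (λ j → w j * u i (κ j) ⁺)       ≈⟨ mixture-⟨⟩ mix (λ l → u i l ⁺) ⟨
        ⟨ q , (λ l → u i l ⁺) ⟩             ∎))

  ∘𝓛-inverse : ∀ (σ τ : Permutation′ m) → (∀ k → τ ⟨$⟩ʳ (σ ⟨$⟩ʳ k) ≡ k) →
               ∀ l → (l ∘𝓛 τ) ∘𝓛 σ ≡ l
  ∘𝓛-inverse σ τ inv l = ≡.trans
    (tabulate-cong λ k → ≡.trans (lookup∘tabulate (λ j → lookup l (τ ⟨$⟩ʳ j)) (σ ⟨$⟩ʳ k))
      (≡.cong (lookup l) (inv k)))
    (tabulate∘lookup l)

  module _ {b : Vector ℝ m} {q : 𝓛 → ℝ} (isSuper : IsSupervertex b q) where

    private
      σ = proj₁ isSuper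
      b↓ = b ∘ (σ ⟨$⟩ˡ_)
      -- `sort` relabels the coordinates of a letter in the way that turns `b` into `b↓`, and
      -- `unsort` undoes it.
      sort unsort : 𝓛 → 𝓛
      sort l = l ∘𝓛 Perm.flip σ
      unsort l = l ∘𝓛 σ
      unsort∘sort : ∀ l → unsort (sort l) ≡ l
      unsort∘sort = ∘𝓛-inverse σ (Perm.flip σ) (λ k → inverseˡ σ)
      sort∘unsort : ∀ l → sort (unsort l) ≡ l
      sort∘unsort = ∘𝓛-inverse (Perm.flip σ) σ (λ k → inverseʳ σ)

    -- `IsSupervertex` describes `q` at the letters `unsort l`. As `unsort` is a bijection, these
    -- are all letters, and the point mass at `μ i` is carried to `unsort (μ i)`.
    supervertex-mixture : Mixture (chainWeight 1# b↓) (unsort ∘ μ) q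
    supervertex-mixture = mixture λ l → begin
      q l
        ≡⟨ ≡.cong q (unsort∘sort l) ⟨
      q (unsort (sort l))
        ≈⟨ proj₂ (proj₂ isSuper) (sort l) ⟩
      sum (λ i → b′ b↓ i * e (μ i) (sort l))
        ≈⟨ sum-cong-≋ (λ i → *-cong (chainWeight≈ 1# b↓ i) (e-cong
             (λ μ≡ → ≡.trans (≡.cong unsort μ≡) (unsort∘sort l))
             (λ κ≡ → ≡.trans (≡.sym (sort∘unsort (μ i))) (≡.cong sort κ≡)))) ⟩
      sum (λ i → chainWeight 1# b↓ i * e (unsort (μ i)) l) ∎

    supervertex∈Polytope : (∀ k → (- 1# ≤ b k) × (b k ≤ 1#)) → q ∈ Polytope b
    supervertex∈Polytope b∈ = mixture∈Polytope supervertex-mixture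
      (chainWeight-nonneg 1# b↓ (proj₁ (proj₂ isSuper)) -1≤1 (λ j → b∈ (σ ⟨$⟩ˡ j)))
      (begin
        sum (chainWeight 1# b↓)   ≈⟨ sum-chainWeight 1# b↓ ⟩
        (1# + 1#) * ½             ≈⟨ solve 1 (λ h → (con (+ 1) :+ con (+ 1)) :* h := h :+ h) ≈-refl ½ ⟩
        ½ + ½                     ≈⟨ ½+½≈1 ⟩
        1#                        ∎)
      λ k → begin
        sum (λ i → chainWeight 1# b↓ i * coordinate k (unsort (μ i)))
          ≈⟨ sum-cong-≋ (λ i → *-congˡ {chainWeight 1# b↓ i} (reflexive (≡.cong ind
               (lookup∘tabulate (λ k → lookup (μ i) (σ ⟨$⟩ʳ k)) k)))) ⟩
        sum (λ i → chainWeight 1# b↓ i * coordinate (σ ⟨$⟩ʳ k) (μ i))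
          ≈⟨ chainWeight-marginal 1# b↓ (σ ⟨$⟩ʳ k) ⟩
        half (b (σ ⟨$⟩ˡ (σ ⟨$⟩ʳ k)) + 1#)
          ≡⟨ ≡.cong (λ j → half (b j + 1#)) (inverseˡ σ) ⟩
        half (b k + 1#) ∎
      where
      -1≤1 : - 1# ≤ 1#
      -1≤1 = 0≤y-x⇒x≤y (≤-resp-≈ (+-identityˡ 0#)
        (solve 0 (con (+ 1) :+ con (+ 1) := con (+ 1) :- :- con (+ 1)) ≈-refl) (+-mono-≤ 0≤1 0≤1))

    -- The chain bound is used in the coordinates that sort `b`, whatever the order of the slopes
    -- `d`, and its increments are carried back along `σ`.
    chain-supporting : Supporting _≤_ (unsort ∘ μ)
    chain-supporting x d 0≤d = x ⁺ , d′ ∘ (σ ⟨$⟩ʳ_) ,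
      (λ l → ≤-resp-≈ (⁺-cong (sorted l)) (sorted′ l)
        (affine⁺≤chain d↓ (λ k → 0≤d (σ ⟨$⟩ˡ k)) ≤-refl (sort l))) ,
      λ i → begin
        affine x d (unsort (μ i)) ⁺           ≈⟨ ⁺-cong (unsorted (μ i)) ⟩
        affine x d↓ (μ i) ⁺                   ≈⟨ affine⁺≈chain x d↓ i ⟩
        affine (x ⁺) d′ (μ i)                 ≈⟨ affine-permute σ (x ⁺) d′ (μ i) ⟨
        affine (x ⁺) (d′ ∘ (σ ⟨$⟩ʳ_)) (unsort (μ i)) ∎
      where
      d↓ d′ : Vector ℝ m
      d↓ = d ∘ (σ ⟨$⟩ˡ_)
      d′ = chainIncrement x d↓
      sorted : ∀ l → affine x d↓ (sort l) ≈ affine x d l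
      sorted = affine-permute (Perm.flip σ) x d
      unsorted : ∀ l → affine x d (unsort l) ≈ affine x d↓ l
      unsorted l = ≈-trans (≈-sym (sorted (unsort l)))
        (reflexive (≡.cong (affine x d↓) (sort∘unsort l)))
      sorted′ : ∀ l → affine (x ⁺) d′ (sort l) ≈ affine (x ⁺) (d′ ∘ (σ ⟨$⟩ʳ_)) l
      sorted′ l = ≈-trans (≈-sym (affine-permute σ (x ⁺) d′ (sort l)))
        (reflexive (≡.cong (affine (x ⁺) (d′ ∘ (σ ⟨$⟩ʳ_))) (unsort∘sort l)))

    supervertex-dominates : (∀ k → (- 1# ≤ b k) × (b k ≤ 1#)) → Dominates _≤_ b q
    supervertex-dominates b∈ = supporting⇒dominates ≤-isOrientation
      (supervertex∈Polytope b∈) supervertex-mixture chain-supporting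

  subvertex-mixture : ∀ b → Mixture (b″ b) ν (subvertex b)
  subvertex-mixture b = mixture λ l → ≈-refl

  star-supporting : Supporting (flip _≤_) ν
  star-supporting x d 0≤d = x ⁺ , starIncrement x d , star≤affine⁺ d 0≤d ≤-refl , affine⁺≈star x d

  subvertex-dominated : ∀ b → subvertex b ∈ Polytope b → Dominates (flip _≤_) b (subvertex b)
  subvertex-dominated b q∈ =
    supporting⇒dominates ≥-isOrientation q∈ (subvertex-mixture b) star-supporting

  -- `ν fzero` differs from every other `ν i`, so the weight `b″ b fzero` can be read off as a value
  -- of the subvertex.
  subvertex-ν₀ : ∀ b → subvertex b (ν fzero) ≈ b″ b fzero
  subvertex-ν₀ b = begin
    sum (λ i → b″ b i * e (ν i) (ν fzero))
      ≈⟨ ∑-single sum-isSummation {λ i → b″ b i * e (ν i) (ν fzero)} fzero off ⟩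
    b″ b fzero * e (ν fzero) (ν fzero)
      ≈⟨ *-congˡ (e-diagonal (ν fzero)) ⟩
    b″ b fzero * 1#
      ≈⟨ *-identityʳ _ ⟩
    b″ b fzero ∎
    where
    off : ∀ i → i ≢ fzero → b″ b i * e (ν i) (ν fzero) ≈ 0#
    off fzero    0≢0 = contradiction ≡.refl 0≢0
    off (fsuc j) _   = ≈-trans (*-congˡ (e-off-diagonal (ν-suc≢ν₀ j))) (zeroʳ _)

  -- The other weights `(b k + 1) / 2` are nonnegative since `- 1# ≤ b k`; only the sign of the
  -- weight at `ν fzero` is in question.
  subvertex∈Polytope⇔ : ∀ b → (∀ k → (- 1# ≤ b k) × (b k ≤ 1#)) →
    subvertex b ∈ Polytope b ⇔ (0# ≤ b″ b fzero)
  subvertex∈Polytope⇔ b b∈ = mk⇔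
    (λ q∈ → ≤-resp-≈ ≈-refl (subvertex-ν₀ b) (proj₁ q∈ (ν fzero)))
    (λ 0≤b″₀ → mixture∈Polytope (subvertex-mixture b)
      (λ where
        fzero    → 0≤b″₀
        (fsuc k) → ≤-resp-≈ ≈-refl
          (*-congʳ (solve 1 (λ b → b :- :- con (+ 1) := b :+ con (+ 1)) ≈-refl (b k)))
          (half-nonneg (proj₁ (b∈ k))))
      (sum-b″ b) (b″-marginal b))

-- Expectations under strategies, cylinders and conditioning.

module Strategies {c ℓ₁ ℓ₂ ℓ₃} (ℛ : RealNumbers c ℓ₁ ℓ₂ ℓ₃) (m : ℕ) where

  open RealNumbers ℛ hiding (zero)
  open OrderedField ℛ hiding (_⁺; half)
  open Summation ℛ
  open IsSummation
  open IsOrientation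
  open Dominance ℛ m
  open Theory ℛ m
  open import Relation.Binary.Reasoning.Setoid setoid

  private
    𝓛-sum = ∑𝓛-isSummation m
    Word-sum : ∀ {n} → IsSummation (∑Word {n})
    Word-sum = ∑Word-isSummation m

  E-congˡ : ∀ {n} {P Q : Word n → ℝ} F → (∀ x → P x ≈ Q x) → E P F ≈ E Q F
  E-congˡ F P≈Q = ∑-cong Word-sum (λ x → *-congʳ (P≈Q x))

  E-congʳ : ∀ {n} (P : Word n → ℝ) {F G} → (∀ x → F x ≈ G x) → E P F ≈ E P G
  E-congʳ P F≈G = ∑-cong Word-sum (λ x → *-congˡ (F≈G x))

  ⟨⟩-E-swap : ∀ p {n} (D : Word n → ℝ) (F : 𝓛 → Word n → ℝ) →
    ⟨ p , (λ l → E D (F l)) ⟩ ≈ E D (λ τ → ⟨ p , (λ l → F l τ) ⟩)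
  ⟨⟩-E-swap p D F = begin
    ⟨ p , (λ l → E D (F l)) ⟩
      ≈⟨ ∑-cong 𝓛-sum (λ l → ∑-* Word-sum (p l) (λ τ → D τ * F l τ)) ⟨
    ∑𝓛 (λ l → ∑Word (λ τ → p l * (D τ * F l τ)))
      ≈⟨ ∑𝓛-∑Word-swap m (λ l τ → p l * (D τ * F l τ)) ⟩
    ∑Word (λ τ → ∑𝓛 (λ l → p l * (D τ * F l τ)))
      ≈⟨ ∑-cong Word-sum (λ τ → ⟨⟩-* p (D τ) (λ l → F l τ)) ⟩
    E D (λ τ → ⟨ p , (λ l → F l τ) ⟩) ∎

  after : ∀ {n} → Strategy (suc n) → 𝓛 → Strategy n
  after Φ l k ω = Φ (fsuc k) (l ∷ ω)

  Admissible : ∀ {n} → Vector ℝ m → Strategy n → Set _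
  Admissible b Φ = ∀ k ω → Φ k ω ∈ Polytope b

  -- The tower property for the first letter: `density Φ (l ∷ τ)` unfolds to the probability of `l`
  -- times the density of the remaining strategy.
  E-density-suc : ∀ {n} (Φ : Strategy (suc n)) F → E (density Φ) F ≈
    ⟨ Φ fzero [] , (λ l → E (density (after Φ l)) (λ τ → F (l ∷ τ))) ⟩
  E-density-suc Φ F = ∑-cong 𝓛-sum λ l → ≈-trans
    (∑-cong Word-sum λ τ → *-assoc (Φ fzero [] l) (density (after Φ l) τ) (F (l ∷ τ)))
    (∑-* Word-sum (Φ fzero [] l) (λ τ → density (after Φ l) τ * F (l ∷ τ)))

  density-nonneg : ∀ {b n} (Φ : Strategy n) → Admissible b Φ → ∀ x → 0# ≤ density Φ x
  density-nonneg Φ Φ∈ []      = 0≤1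
  density-nonneg Φ Φ∈ (l ∷ τ) = *-nonneg (proj₁ (Φ∈ fzero []) l)
    (density-nonneg (after Φ l) (λ k ω → Φ∈ (fsuc k) (l ∷ ω)) τ)

  E-density-1 : ∀ {b n} (Φ : Strategy n) → Admissible b Φ → E (density Φ) (λ _ → 1#) ≈ 1#
  E-density-1 {n = zero}  Φ Φ∈ = *-identityˡ 1#
  E-density-1 {b} {suc n} Φ Φ∈ = begin
    E (density Φ) (λ _ → 1#)
      ≈⟨ E-density-suc Φ (λ _ → 1#) ⟩
    ⟨ Φ fzero [] , (λ l → E (density (after Φ l)) (λ _ → 1#)) ⟩
      ≈⟨ ⟨⟩-congʳ (Φ fzero []) (λ l → E-density-1 (after Φ l) (λ k ω → Φ∈ (fsuc k) (l ∷ ω))) ⟩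
    ⟨ Φ fzero [] , ℓ fzero ⟩
      ≈⟨ total-mass {b} (Φ∈ fzero []) ⟩
    1# ∎

  truncatedPositive-head : ∀ {n} (F : Word (suc n) → ℝ) → TruncatedPositive F →
    ∀ τ → (λ l → F (l ∷ τ)) ∈ Uℓ-pos⁺
  truncatedPositive-head F F⁺ τ = Uℓ-pos⁺-resp-≈
    (λ l → reflexive (≡.cong (λ τ → F (l ∷ τ)) (cast-is-id ≡.refl τ))) (F⁺ ≡.refl [] τ)

  truncatedPositive-tail : ∀ {n} (F : Word (suc n) → ℝ) → TruncatedPositive F →
    ∀ l → TruncatedPositive (λ τ → F (l ∷ τ))
  truncatedPositive-tail F F⁺ l eq ω τ = F⁺ (≡.cong suc eq) (l ∷ ω) τ

  module _ {n j k} {ω : Word j} (eq : j ℕ.+ k ≡ n) where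

    𝟙-cylinder-here : ∀ l τ →
      𝟙 (Cylinder? (≡.cong suc eq) (l ∷ ω)) (l ∷ τ) ≈ 𝟙 (Cylinder? eq ω) τ
    𝟙-cylinder-here l τ = reflexive (≡.cong (if_then 1# else 0#) (does-⇔
      (mk⇔ (λ (ρ , x≡) → ρ , ∷-injectiveʳ x≡) (λ (ρ , τ≡) → ρ , ≡.cong (l ∷_) τ≡))
      (Cylinder? (≡.cong suc eq) (l ∷ ω) (l ∷ τ)) (Cylinder? eq ω τ)))

    𝟙-cylinder-elsewhere : ∀ {l l′} → l′ ≢ l → ∀ τ →
      𝟙 (Cylinder? (≡.cong suc eq) (l ∷ ω)) (l′ ∷ τ) ≈ 0#
    𝟙-cylinder-elsewhere {l} {l′} l′≢l τ = reflexive (≡.cong (if_then 1# else 0#)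
      (dec-false (Cylinder? (≡.cong suc eq) (l ∷ ω) (l′ ∷ τ))
        (λ (ρ , x≡) → l′≢l (∷-injectiveˡ x≡))))

  𝟙-cylinder-[] : ∀ {n} (x : Word n) → 𝟙 (Cylinder? ≡.refl []) x ≈ 1#
  𝟙-cylinder-[] x = reflexive (≡.cong (if_then 1# else 0#)
    (dec-true (Cylinder? ≡.refl [] x) (x , ≡.sym (cast-is-id ≡.refl x))))

  E-density-first : ∀ {n} (Φ : Strategy (suc n)) F l → (∀ l′ τ → l′ ≢ l → F (l′ ∷ τ) ≈ 0#) →
    E (density Φ) F ≈ Φ fzero [] l * E (density (after Φ l)) (λ τ → F (l ∷ τ))
  E-density-first Φ F l F≈0 = ≈-trans (E-density-suc Φ F)
    (∑-single 𝓛-sum l λ l′ l′≢l → ≈-trans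
      (*-congˡ (∑-zero Word-sum λ τ → ≈-trans (*-congˡ (F≈0 l′ τ l′≢l)) (zeroʳ _)))
      (zeroʳ _))

  -- The density of the constant strategy `q` is the product density by definition.
  E⊗-attained : ∀ {b q} → q ∈ Polytope b → ∀ {n} (F : Word n → ℝ) →
                ∃[ P ] P ∈ Γ n b × E P F ≈ E⊗ q F
  E⊗-attained {q = q} q∈ F =
    q ⊗^ _ , ((λ _ _ → q) , (λ _ _ → q∈) , λ _ → ≈-refl) , ≈-refl

  module _ {_≼_ : Rel ℝ ℓ₃} (O : IsOrientation _≼_) {b : Vector ℝ m} {q : 𝓛 → ℝ}
           (q∈ : q ∈ Polytope b) (dominates : Dominates _≼_ b q) where

    -- By induction the steps after the first are replaced by `q`. Exchanging sums then fixes the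
    -- tail `τ`, so that dominance applies to the first letter alone.
    E-density≼E⊗ : ∀ {n} (Φ : Strategy n) → Admissible b Φ →
      ∀ {F} → TruncatedPositive F → E (density Φ) F ≼ E⊗ q F
    E-density≼E⊗ {zero}  Φ Φ∈ F⁺ = ≼-reflexive O ≈-refl
    E-density≼E⊗ {suc n} Φ Φ∈ {F} F⁺ =
      ≼-trans O (≼-reflexive O (E-density-suc Φ F))
      (≼-trans O (⟨⟩-mono O (proj₁ (Φ∈ fzero [])) λ l →
        E-density≼E⊗ (after Φ l) (λ k ω → Φ∈ (fsuc k) (l ∷ ω)) (truncatedPositive-tail F F⁺ l))
      (≼-trans O (≼-reflexive O (⟨⟩-E-swap (Φ fzero []) (q ⊗^ n) (λ l τ → F (l ∷ τ))))
      (≼-trans O (∑-mono-≼ O Word-sum λ τ → *-monoˡ O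
        -- `q ⊗^ n` is the density of a constant strategy, hence nonnegative.
        (density-nonneg {b} (λ _ _ → q) (λ _ _ → q∈) τ)
        (dominates (Φ∈ fzero []) (truncatedPositive-head F F⁺ τ)))
      (≼-reflexive O (≈-trans (≈-sym (⟨⟩-E-swap q (q ⊗^ n) (λ l τ → F (l ∷ τ))))
        (≈-sym (E-density-suc (λ _ _ → q) F)))))))

    -- The division-free form also covers cylinders of probability zero. Along `ω` the indicator
    -- selects one first letter, which contributes the same factor `Φ fzero [] l` to both sides,
    -- until the bound for whole words applies.
    E-cylinder≼ : ∀ {n} (Φ : Strategy n) → Admissible b Φ → ∀ {F} → TruncatedPositive F →
      ∀ {j k} (eq : j ℕ.+ k ≡ n) (ω : Word j) →
      E (density Φ) (λ x → 𝟙 (Cylinder? eq ω) x * F x) ≼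
        (prob (density Φ) (Cylinder? eq ω) * E⊗ q (restrict eq F ω))
    E-cylinder≼ Φ Φ∈ {F} F⁺ ≡.refl [] = resp-≈ O
      (E-congʳ (density Φ) λ x → ≈-sym (≈-trans (*-congʳ (𝟙-cylinder-[] x)) (*-identityˡ (F x))))
      (begin
        E⊗ q F
          ≈⟨ *-identityˡ _ ⟨
        1# * E⊗ q F
          ≈⟨ *-cong
               (≈-trans (E-congʳ (density Φ) 𝟙-cylinder-[]) (E-density-1 {b} Φ Φ∈))
               (E-congʳ (q ⊗^ _) λ τ → reflexive (≡.cong F (cast-is-id ≡.refl τ))) ⟨
        prob (density Φ) (Cylinder? ≡.refl []) * E⊗ q (restrict ≡.refl F []) ∎)
      (E-density≼E⊗ Φ Φ∈ F⁺)
    E-cylinder≼ Φ Φ∈ {F} F⁺ ≡.refl (l ∷ ω) = resp-≈ O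
      (begin
        Φ fzero [] l * E (density Φₗ) (λ τ → 𝟙 (Cylinder? ≡.refl ω) τ * F (l ∷ τ))
          ≈⟨ *-congˡ (E-congʳ (density Φₗ) λ τ → *-congʳ (𝟙-cylinder-here ≡.refl l τ)) ⟨
        Φ fzero [] l * E (density Φₗ) (λ τ → 𝟙 (Cylinder? ≡.refl (l ∷ ω)) (l ∷ τ) * F (l ∷ τ))
          ≈⟨ E-density-first Φ (λ x → 𝟙 (Cylinder? ≡.refl (l ∷ ω)) x * F x) l (λ l′ τ l′≢l →
               ≈-trans (*-congʳ (𝟙-cylinder-elsewhere ≡.refl l′≢l τ)) (zeroˡ (F (l′ ∷ τ)))) ⟨
        E (density Φ) (λ x → 𝟙 (Cylinder? ≡.refl (l ∷ ω)) x * F x) ∎)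
      (begin
        Φ fzero [] l * (prob (density Φₗ) (Cylinder? ≡.refl ω) * X)
          ≈⟨ *-assoc _ _ _ ⟨
        Φ fzero [] l * prob (density Φₗ) (Cylinder? ≡.refl ω) * X
          ≈⟨ *-congʳ (*-congˡ (E-congʳ (density Φₗ) (𝟙-cylinder-here ≡.refl l))) ⟨
        Φ fzero [] l * E (density Φₗ) (λ τ → 𝟙 (Cylinder? ≡.refl (l ∷ ω)) (l ∷ τ)) * X
          ≈⟨ *-congʳ (E-density-first Φ (𝟙 (Cylinder? ≡.refl (l ∷ ω))) l (λ l′ τ l′≢l →
               𝟙-cylinder-elsewhere ≡.refl l′≢l τ)) ⟨
        prob (density Φ) (Cylinder? ≡.refl (l ∷ ω)) * X ∎)
      (*-monoˡ O (proj₁ (Φ∈ fzero []) l) (E-cylinder≼ Φₗ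
        (λ k ω → Φ∈ (fsuc k) (l ∷ ω)) (truncatedPositive-tail F F⁺ l) ≡.refl ω))
      where
      Φₗ = after Φ l
      X = E⊗ q (restrict ≡.refl (λ τ → F (l ∷ τ)) ω)

    condE≼E⊗ : ∀ {n} {P F : Word n → ℝ} → P ∈ Γ n b → TruncatedPositive F →
      ∀ {j k} (eq : j ℕ.+ k ≡ n) (ω : Word j) (pos : 0# < prob P (Cylinder? eq ω)) →
      condE P F (Cylinder? eq ω) pos ≼ E⊗ q (restrict eq F ω)
    condE≼E⊗ {P = P} {F} (Φ , Φ∈ , P≈) F⁺ eq ω pos = resp-≈ O
      (begin
        r * E (density Φ) (λ x → 𝟙 A? x * F x)  ≈⟨ *-comm _ _ ⟩
        E (density Φ) (λ x → 𝟙 A? x * F x) * r  ≈⟨ *-congʳ (E-congˡ _ P≈) ⟨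
        condE P F A? pos                        ∎)
      (begin
        r * (prob (density Φ) A? * X)           ≈⟨ *-assoc _ _ _ ⟨
        r * prob (density Φ) A? * X             ≈⟨ *-congʳ (*-congˡ (E-congˡ (𝟙 A?) P≈)) ⟨
        r * prob P A? * X                       ≈⟨ *-congʳ (recip-inverse pos) ⟩
        1# * X                                  ≈⟨ *-identityˡ X ⟩
        X                                       ∎)
      (*-monoˡ O (recip-nonneg pos) (E-cylinder≼ Φ Φ∈ F⁺ eq ω))
      where
      A? = Cylinder? eq ω
      r = recip pos
      X = E⊗ q (restrict eq F ω)

    E≼E⊗ : ∀ {n} {P F : Word n → ℝ} → P ∈ Γ n b → TruncatedPositive F → E P F ≼ E⊗ q F
    E≼E⊗ {F = F} (Φ , Φ∈ , P≈) F⁺ =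
      ≼-trans O (≼-reflexive O (E-congˡ F P≈)) (E-density≼E⊗ Φ Φ∈ F⁺)

-- Bounds for conditional expectations and the extreme values over `Γ`.

open import Data.Nat.Base using (_+_)

theorem1p10 :
  ∀ {c ℓ₁ ℓ₂ ℓ₃} (ℛ : RealNumbers c ℓ₁ ℓ₂ ℓ₃)
  (m n : ℕ) .{{_ : NonZero m}} .{{_ : NonZero n}} →
  let open RealNumbers ℛ renaming (_+_ to _+ᴿ_)
      open Theory ℛ m
  in
  (b : Vector ℝ m) → (∀ i → (- 1# ≤ b i) × (b i ≤ 1#)) →
  ((subvertex b ∈ Polytope b) ⇔
    (1# ÷ fromℕ m [ fromℕ-pos m ] * sum b ≤ fromℕ 2 ÷ fromℕ m [ fromℕ-pos m ] - 1#))
  ×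
  ((F : Word n → ℝ) → TruncatedPositive F →
    ((q* : 𝓛 → ℝ) → IsSupervertex b q* →
      ((P : Word n → ℝ) → P ∈ Γ n b →
        ∀ {j k} (eq : j + k ≡ n) (ω : Word j)
        (pos : 0# < prob P (Cylinder? eq ω)) →
        condE P F (Cylinder? eq ω) pos ≤ E⊗ q* (restrict eq F ω))
      × IsMaximum (Γ n b) (λ P → E P F) (E⊗ q* F))
    ×
    (subvertex b ∈ Polytope b →
      ((P : Word n → ℝ) → P ∈ Γ n b →
        ∀ {j k} (eq : j + k ≡ n) (ω : Word j)
        (pos : 0# < prob P (Cylinder? eq ω)) →
        E⊗ (subvertex b) (restrict eq F ω) ≤ condE P F (Cylinder? eq ω) pos)
      × IsMinimum (Γ n b) (λ P → E P F) (E⊗ (subvertex b) F)))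
theorem1p10 ℛ m n b b∈ =
  -- Membership and the bound on the mean of `b` are compared through the sign of `b″ b fzero`.
  ⇔.trans (subvertex∈Polytope⇔ b b∈) (b″₀-nonneg⇔ b) ,
  λ F F⁺ →
    (λ q* isSuper →
      let q∈ = supervertex∈Polytope {q = q*} isSuper b∈
          dominates = supervertex-dominates {q = q*} isSuper b∈
      in (λ P P∈ eq ω pos → condE≼E⊗ ≤-isOrientation q∈ dominates P∈ F⁺ eq ω pos) ,
         E⊗-attained {b} q∈ F ,
         λ P P∈ → E≼E⊗ ≤-isOrientation q∈ dominates P∈ F⁺) ,
    λ q∈ →
      let dominated = subvertex-dominated b q∈
      in (λ P P∈ eq ω pos → condE≼E⊗ ≥-isOrientation q∈ dominated P∈ F⁺ eq ω pos) ,
         E⊗-attained {b} q∈ F ,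
         λ P P∈ → E≼E⊗ ≥-isOrientation q∈ dominated P∈ F⁺
  where
  open Summation ℛ using (≤-isOrientation; ≥-isOrientation)
  open Vertices ℛ using (b″₀-nonneg⇔)
  open Dominance ℛ m
  open Strategies ℛ m
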